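{- Let $\mathbf{A}=\mathcal{A}_1\parallel\cdots\parallel\mathcal{A}_n$ be a parallel composition of finite labelled transition systems with interface $\mathcal{A}_i$, and assume $\mathbf{A}$ is non-divergent (with respect to the interface $\mathcal{A}_i$). Then, for every way of resolving the nondeterministic choices, the unfolding procedure (Algorithm 1) with cut-off definition 1 terminates and returns a finite branching process $\mathcal{N}$ of $\mathbf{A}$, and the folding $\mathcal{S}_i$ of the interface projection $\mathcal{N}_i$ is a summary of $\mathbf{A}$, i.e. $\mathrm{Tr}(\mathcal{S}_i)=\mathrm{Tr}(\mathbf{A})|_{\Sigma_i}$.
   Context: Labelled transition systems. An LTS is $\mathcal{A}=(\Sigma,S,T,\lambda,s^0)$ with a set of actions $\Sigma$, a set of states $S$, transitions $T\subseteq S\times S$, a labelling $\lambda:T\to\Sigma$ and an initial state $s^0$. An execution is a finite or infinite sequence $t_1t_2\cdots$ of transitions such that there are states $s_0s_1\cdots$ with $t_k=(s_{k-1},s_k)$; it is a history if $s_0=s^0$. A (finite or infinite) sequence of actions is a trace if it equals $\lambda(t_1)\lambda(t_2)\cdots$ for some history $t_1t_2\cdots$ (a realization of it). $\mathrm{Tr}(\mathcal{A})$ is the set of traces. Parallel composition. For $\mathcal{A}_j=(\Sigma_j,S_j,T_j,\lambda_j,s^0_j)$, $j=1,\dots,n$, the LTS $\mathbf{A}=\mathcal{A}_1\parallel\cdots\parallel\mathcal{A}_n$ has actions $\Sigma_1\cup\cdots\cup\Sigma_n$, states (global states) the tuples $(s_1,\dots,s_n)$ with $s_j\in S_j$, initial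 state $(s^0_1,\dots,s^0_n)$, and global transitions the tuples $\mathbf{t}=(t_1,\dots,t_n)\in\prod_j(T_j\cup\{\star\})$, not all $\star$, such that for some action $a$ and every $j$: $t_j$ is an $a$-labelled transition of $T_j$ if $a\in\Sigma_j$ and $t_j=\star$ otherwise; $\mathbf{t}$ is labelled $a$ and leads from $(s_1,\dots,s_n)$ to $(s_1',\dots,s_n')$ where $s'_j=s_j$ if $t_j=\star$ and $t_j=(s_j,s_j')$ otherwise. $\mathcal{A}_j$ participates in $\mathbf{t}$ if $t_j\neq\star$. A fixed index $i$ is distinguished; $\mathcal{A}_i$ is the interface. For a set $X$ of sequences, $X|_{\Sigma_i}$ denotes the set of their projections onto $\Sigma_i$ (erasing all other letters). A summary of $\mathbf{A}$ is an LTS $\mathcal{S}_i$ with action set $\Sigma_i$ and $\mathrm{Tr}(\mathcal{S}_i)=\mathrm{Tr}(\mathbf{A})|_{\Sigma_i}$. $\mathbf{A}$ is divergent if some infinite trace of $\mathbf{A}$ contains only finitely many occurrences of actions of $\Sigma_i$; otherwise non-divergent. Branching processes. These are Petri nets whose places are called conditions and transitions events; $\bullet x$ and $x\bullet$ denote input and output sets; a transition is enabled at a marking (set of places) $M$ if $\bullet t\subseteq M$, and firing yields $(M\setminus\bullet t)\cup t\bullet$. Finite branching processes of $\mathbf{A}$ are defined inductively: (1) the net with conditions $b^0_1,\dots,b^0_n$ labelled $s^0_1,\dots,s^0_n$, no events, and initial marking $\{b^0_1,\dots,b^0_n\}$ is one; (2) if $\mathcal{N}$ is one, $M'$ a reachable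 marking of $\mathcal{N}$, $\mathbf{t}$ a global transition such that for each participating $j$ with $t_j=(s_j,s_j')$ some condition of $M'$ is labelled $s_j$, $M$ is the set of these conditions, and $\mathcal{N}$ has no event labelled $\mathbf{t}$ with input set $M$, then adding a new event $e$ labelled $\mathbf{t}$ (hence with action label that of $\mathbf{t}$), with $\bullet e=M$ and with new output conditions labelled $s'_j$ for each participating $j$, yields a branching process. Such an $e$ is a possible extension of $\mathcal{N}$. For nodes $x,y$: $x<y$ if there is a nonempty directed path from $x$ to $y$; $x\#y$ (conflict) if some condition $z\neq x,y$ has paths to $x$ and to $y$ leaving $z$ by different arcs; $x,y$ are concurrent if neither $x\le y$, $y\le x$ nor $x\#y$. The past of $e$ is $[e]=\{e':e'\le e\}$; $M(e)$ is the marking reached by any occurrence sequence firing exactly the events of $[e]$; it contains exactly one condition labelled by a state of $\mathcal{A}_j$, denoted $M(e)_j$; $\mathrm{St}(e)$ is the global state formed by the labels of $M(e)$. An $i$-event is an event in whose label $\mathcal{A}_i$ participates; an $i$-condition is a condition labelled by a state of $\mathcal{A}_i$. Interface projection and folding. $\mathcal{N}_i$ is the subnet of $\mathcal{N}$ with the $i$-conditions, the $i$-events and the arcs between them; each $i$-event has one input and one output $i$-condition, so $\mathcal{N}_i$ is an LTS with states the $i$-conditions, initial state $b^0_i$, and for each $i$-event a transition from its input to its output $i$-condition labelled by its action. Given an equivalence $\equiv$ on $i$-conditions, the folding of $\mathcal{N}_i$ is the LTS whose states are the $\equiv$-classes, initial state $[b^0_i]_\equiv$, with a transition $([b]_\equiv,[b']_\equiv)$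 labelled $a$ for each $a$-labelled transition $(b,b')$ of $\mathcal{N}_i$. Algorithm 1 with cut-off definition 1. Start with the branching process without events and $co=\emptyset$. While there is a possible extension of the current $\mathcal{N}$ having no event of $co$ among its causal predecessors, choose any such $e$, add it to $\mathcal{N}$, and if $e$ is a cut-off add it to $co$. Here $e$ is a cut-off if $e$ is an $i$-event and $\mathcal{N}$ already contains an $i$-event $e'$ with $\mathrm{St}(e)=\mathrm{St}(e')$; $e'$ is its companion. At the end, $\equiv$ is the equivalence on $i$-conditions generated by $M(e)_i\equiv M(e')_i$ for every $e\in co$ with companion $e'$. -}

module Defs where

open import Data.Nat using (ℕ; zero; suc; _≤_; _<_)
open import Data.Fin using (Fin)
open import Data.Bool using (Bool; true; false; if_then_else_)
open import Data.Maybe using (Maybe; just; nothing)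
open import Data.List using (List; []; _∷_; _++_; [_]; map; length)
open import Data.List.Membership.Propositional using (_∈_)
open import Data.Product using (Σ; ∃; ∃-syntax; _×_; _,_; proj₁)
open import Data.Sum using (_⊎_)
open import Relation.Nullary using (¬_)
open import Relation.Binary.PropositionalEquality using (_≡_)
open import Relation.Binary.Construct.Closure.Equivalence using (EqClosure)
open import Relation.Binary.Construct.Closure.ReflexiveTransitive using (Star)
open import Induction.WellFounded using (Acc)
open import Function.Bundles using (_⇔_)

-- Finite labelled transition systems over the global action set Fin k.
-- Component alphabet Σ_j is the Boolean predicate 'alph'.
-- T ⊆ S × S together with λ : T → Σ is encoded by δ : S → S → Maybe Σ
-- (δ s s' ≡ just a  iff  (s,s') ∈ T and λ(s,s') = a).

record FLTS (k : ℕ) : Set where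
  field
    alph  : Fin k → Bool
    nS    : ℕ
    δ     : Fin nS → Fin nS → Maybe (Fin k)
    δ-alph : ∀ s s' a → δ s s' ≡ just a → alph a ≡ true
    s0    : Fin nS

open FLTS public

nth : {X : Set} → List X → ℕ → Maybe X
nth []       _       = nothing
nth (x ∷ xs) zero    = just x
nth (x ∷ xs) (suc m) = nth xs m

module Composition {k n : ℕ} (A : Fin n → FLTS k) (i : Fin n) where

  GS : Set
  GS = (j : Fin n) → Fin (nS (A j))

  gs0 : GS
  gs0 j = s0 (A j)

  -- raw global transition data: action and, per component, a local
  -- transition (s , s') or ⋆ (= nothing)
  record GT : Set where
    constructor mkGT
    field
      act : Fin k
      loc : (j : Fin n) → Maybe (Fin (nS (A j)) × Fin (nS (A j)))
  open GT public

  data LocOK (j : Fin n) (a : Fin k) : Maybe (Fin (nS (A j)) × Fin (nS (A j))) → Set where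
    part    : ∀ {s s'} → δ (A j) s s' ≡ just a → LocOK j a (just (s , s'))
    nonpart : alph (A j) a ≡ false → LocOK j a nothing

  -- a global transition: not all ⋆, and each component as required
  ValidGT : GT → Set
  ValidGT t = (∃[ j ] alph (A j) (act t) ≡ true) × (∀ j → LocOK j (act t) (loc t j))

  data LocStep {j : Fin n} : Fin (nS (A j)) → Maybe (Fin (nS (A j)) × Fin (nS (A j))) → Fin (nS (A j)) → Set where
    stay : ∀ {s} → LocStep s nothing s
    move : ∀ {s s'} → LocStep s (just (s , s')) s'

  GStep : GS → GT → GS → Set
  GStep g t g' = ValidGT t × (∀ j → LocStep (g j) (loc t j) (g' j))

  data FinRun : GS → List GT → Set where
    []  : ∀ {g} → FinRun g []
    _∷_ : ∀ {g t g' ts} → GStep g t g' → FinRun g' ts → FinRun g (t ∷ ts)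

  FinTrace : List (Fin k) → Set
  FinTrace w = ∃[ ts ] FinRun gs0 ts × map act ts ≡ w

  InfTrace : (ℕ → Fin k) → Set
  InfTrace w = Σ (ℕ → GT) λ ts → Σ (ℕ → GS) λ gs →
    (∀ j → gs 0 j ≡ gs0 j) × (∀ m → GStep (gs m) (ts m) (gs (suc m))) × (∀ m → w m ≡ act (ts m))

  inI : Fin k → Bool
  inI = alph (A i)

  Divergent : Set
  Divergent = Σ (ℕ → Fin k) λ w → InfTrace w × ∃[ N ] (∀ m → N ≤ m → inI (w m) ≡ false)

  NonDivergent : Set
  NonDivergent = ¬ Divergent

  projL : List (Fin k) → List (Fin k)
  projL []       = []
  projL (a ∷ w) = if inI a then a ∷ projL w else projL w

  prefix : (ℕ → Fin k) → ℕ → List (Fin k)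
  prefix w zero    = []
  prefix w (suc N) = w 0 ∷ prefix (λ m → w (suc m)) N

  FinProjOfInf : (ℕ → Fin k) → List (Fin k) → Set
  FinProjOfInf w u = ∃[ N ] (projL (prefix w N) ≡ u × (∀ m → N ≤ m → inI (w m) ≡ false))

  InfProjOfInf : (ℕ → Fin k) → (ℕ → Fin k) → Set
  InfProjOfInf w u = Σ (ℕ → ℕ) λ f →
    (∀ l → f l < f (suc l)) × (∀ l → inI (w (f l)) ≡ true) × (∀ l → w (f l) ≡ u l)
    × (∀ m → inI (w m) ≡ true → ∃[ l ] f l ≡ m)

  ProjFin : List (Fin k) → Set
  ProjFin u = (∃[ w ] FinTrace w × projL w ≡ u) ⊎ (Σ (ℕ → Fin k) λ w → InfTrace w × FinProjOfInf w u)

  ProjInf : (ℕ → Fin k) → Set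
  ProjInf u = Σ (ℕ → Fin k) λ w → InfTrace w × InfProjOfInf w u

  -- Branching processes.
  -- Events are numbered 0,1,2,… in order of addition.  The j-condition
  -- 'nothing' is b⁰_j; the j-condition 'just m' is the output condition
  -- of event m labelled by a state of A_j.  The preset of an event is
  -- given by 'pre j' for each participating j ('nothing' for the others).

  record Ev : Set where
    constructor mkEv
    field
      gt    : GT
      valid : ValidGT gt
      pre   : Fin n → Maybe ℕ
  open Ev public

  Events : Set
  Events = List Ev

  data CondLab (es : Events) (j : Fin n) : Maybe ℕ → Fin (nS (A j)) → Set where
    init : CondLab es j nothing (s0 (A j))
    out  : ∀ {m e s s'} → nth es m ≡ just e → loc (gt e) j ≡ just (s , s') → CondLab es j (just m) s'

  -- a marking (reachable markings contain one j-condition per j)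
  Marking : Set
  Marking = Fin n → Maybe ℕ

  M0 : Marking
  M0 _ = nothing

  data FireLoc (m : ℕ) {j : Fin n} : Maybe (Fin (nS (A j)) × Fin (nS (A j))) → Maybe ℕ → Maybe ℕ → Maybe ℕ → Set where
    fstay : ∀ {p c} → FireLoc m nothing p c c
    fmove : ∀ {x c} → FireLoc m (just x) c c (just m)

  Fire : Events → Marking → ℕ → Marking → Set
  Fire es M m M' = ∃[ e ] nth es m ≡ just e × (∀ j → FireLoc m (loc (gt e) j) (pre e j) (M j) (M' j))

  data Occ (es : Events) : Marking → List ℕ → Marking → Set where
    []  : ∀ {M} → Occ es M [] M
    _∷_ : ∀ {M m M' ms M''} → Fire es M m M' → Occ es M' ms M'' → Occ es M (m ∷ ms) M''

  ReachM : Events → Marking → Set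
  ReachM es M = ∃[ ms ] Occ es M0 ms M

  data Past (es : Events) : ℕ → ℕ → Set where
    here : ∀ {m} → Past es m m
    back : ∀ {m m' m'' e j} → nth es m' ≡ just e → pre e j ≡ just m'' → Past es m m'' → Past es m m'

  Before : Events → (Fin n → Maybe ℕ) → ℕ → Set
  Before es p m = ∃[ j ] ∃[ m' ] (p j ≡ just m' × Past es m m')

  MarkOf : Events → ℕ → Marking → Set
  MarkOf es e M = ∃[ ms ] Occ es M0 ms M × (∀ m → (m ∈ ms ⇔ Past es m e))

  StOf : Events → ℕ → GS → Set
  StOf es e g = ∃[ M ] MarkOf es e M × (∀ j → CondLab es j (M j) (g j))

  SameSt : Events → ℕ → ℕ → Set
  SameSt es e e' = ∃[ g ] StOf es e g × StOf es e' g

  data ExtLoc (es : Events) (j : Fin n) : Maybe (Fin (nS (A j)) × Fin (nS (A j))) → Maybe ℕ → Maybe ℕ → Set where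
    enone : ∀ {c} → ExtLoc es j nothing nothing c
    esome : ∀ {c s s'} → CondLab es j c s → ExtLoc es j (just (s , s')) c c

  SameEv : Ev → Ev → Set
  SameEv e e' = act (gt e) ≡ act (gt e') × (∀ j → loc (gt e) j ≡ loc (gt e') j) × (∀ j → pre e j ≡ pre e' j)

  PossExt : Events → Ev → Set
  PossExt es e =
    (∃[ M' ] ReachM es M' × (∀ j → ExtLoc es j (loc (gt e) j) (pre e j) (M' j)))
    × ¬ (∃[ m ] ∃[ e' ] (nth es m ≡ just e' × SameEv e e'))

  data IsBP : Events → Set where
    bp0   : IsBP []
    bpext : ∀ {es e} → IsBP es → PossExt es e → IsBP (es ++ [ e ])

  -- Algorithm 1 with cut-off definition 1.
  -- A configuration lists the events added so far, each with
  -- 'just e'' if it is a cut-off with (chosen) companion e', 'nothing' otherwise.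

  Config : Set
  Config = List (Ev × Maybe ℕ)

  evs : Config → Events
  evs c = map proj₁ c

  IsIEv : Ev → Set
  IsIEv e = inI (act (gt e)) ≡ true

  InCo : Config → ℕ → Set
  InCo c m = ∃[ e ] ∃[ m' ] nth c m ≡ just (e , just m')

  Blocked : Config → Ev → Set
  Blocked c e = ∃[ m ] Before (evs c) (pre e) m × InCo c m

  -- e' (already in N) is a companion of the new event (index length c)
  Companion : Config → Ev → ℕ → Set
  Companion c e m = m < length c × (∃[ e' ] nth (evs c) m ≡ just e' × IsIEv e')
    × SameSt (evs c ++ [ e ]) (length c) m

  data Step (c : Config) : Config → Set where
    scut   : ∀ {e m} → PossExt (evs c) e → ¬ Blocked c e → IsIEv e → Companion c e m
           → Step c (c ++ [ (e , just m) ])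
    snocut : ∀ {e} → PossExt (evs c) e → ¬ Blocked c e → ¬ (IsIEv e × ∃[ m ] Companion c e m)
           → Step c (c ++ [ (e , nothing) ])

  Reachable : Config → Set
  Reachable c = Star Step [] c

  Final : Config → Set
  Final c = ¬ (∃[ e ] PossExt (evs c) e × ¬ Blocked c e)

  Terminates : Set
  Terminates = Acc (λ c' c → Step c c') []

  Gen : Config → Maybe ℕ → Maybe ℕ → Set
  Gen c b b' = ∃[ e ] ∃[ ev ] ∃[ e' ] (nth c e ≡ just (ev , just e') ×
    (∃[ M ] ∃[ M' ] MarkOf (evs c) e M × MarkOf (evs c) e' M' × M i ≡ b × M' i ≡ b'))

  Equiv : Config → Maybe ℕ → Maybe ℕ → Set
  Equiv c = EqClosure (Gen c)

  data FoldRun (c : Config) : Maybe ℕ → List (Fin k) → Set where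
    []   : ∀ {b} → FoldRun c b []
    step : ∀ {b m e w} → nth (evs c) m ≡ just e → IsIEv e → Equiv c b (pre e i)
         → FoldRun c (just m) w → FoldRun c b (act (gt e) ∷ w)

  FoldFin : Config → List (Fin k) → Set
  FoldFin c w = FoldRun c nothing w

  FoldInf : Config → (ℕ → Fin k) → Set
  FoldInf c w = Σ (ℕ → ℕ) λ ms → Σ (ℕ → Ev) λ es →
    (∀ l → nth (evs c) (ms l) ≡ just (es l)) × (∀ l → IsIEv (es l))
    × Equiv c nothing (pre (es 0) i)
    × (∀ l → Equiv c (just (ms l)) (pre (es (suc l)) i))
    × (∀ l → w l ≡ act (gt (es l)))

  IsSummary : Config → Set
  IsSummary c = (∀ u → FoldFin c u ⇔ ProjFin u) × (∀ u → FoldInf c u ⇔ ProjInf u)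

{-# OPTIONS --safe #-}

-- The events fired along an occurrence sequence determine the marking it
-- reaches, and the events of a causally closed subset may always be fired first.
--
-- Termination: all events in the strict past of an event are uncut, and uncut
-- i-events have distinct states.  If such a past is long, then along one of its
-- linearisations the pair (global state, state of the latest i-event) repeats;
-- the i-condition is then the same at both points, so the loop between them
-- is silent and A diverges.  Hence causal depth is bounded, and there are only
-- finitely many events of bounded depth, an event being determined by its
-- transition and its preset.
--
-- Soundness: if the i-event e consumes the i-condition produced by e', then
-- firing [e'] before the rest of [e] gives a run St(e') → St(e) whose only
-- interface action is the last one; equivalent i-conditions have equal states.
--
-- Completeness: by finality, a run from the state of an uncut i-event can be
-- replayed in the net up to its first interface action, performed by some i-event f.
-- The events fired outside [f] are postponed, so the run continues from St(f),
-- hence also from the state of the uncut event reached from f through companions.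
module Submission where

open import Defs
open import Data.Bool using (true; false; if_then_else_)
open import Data.Fin using (Fin; zero; suc; toℕ; combine)
open import Data.Fin.Properties using (any?; all?; pigeonhole; toℕ<n; combine-injective) renaming (_≟_ to _≟ᶠ_; suc-injective to sucᶠ-injective)
open import Data.List using (List; []; _∷_; _++_; [_]; map; length; filter)
open import Data.List.Membership.Propositional using (_∈_)
open import Data.List.Membership.Propositional.Properties using (∈-++⁺ˡ; ∈-++⁺ʳ; ∈-++⁻; ∈-filter⁺; ∈-filter⁻)
open import Data.List.Properties using (map-++; length-++; length-map; ++-identityʳ)
open import Data.List.Relation.Unary.Any using (here; there)
open import Data.Maybe using (Maybe; just; nothing; maybe′)
import Data.Maybe as Maybe
open import Data.Maybe.Properties using (just-injective)
import Data.Maybe.Properties as Maybeₚ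
open import Data.Nat using (ℕ; zero; suc; _+_; _*_; _∸_; _≤_; _<_; _≤′_; ≤′-refl; ≤′-step; z≤n; s≤s; s≤s⁻¹)
open import Data.Nat.Properties
open import Data.Product using (Σ; ∃-syntax; _×_; _,_; proj₁; proj₂)
import Data.Product.Properties as Productₚ
open import Data.Sum using (_⊎_; inj₁; inj₂)
open import Function using (_∘_; case_of_)
open import Function.Bundles using (_⇔_; mk⇔; Equivalence)
open import Induction.WellFounded using (Acc; acc)
open import Relation.Binary.Construct.Closure.ReflexiveTransitive using (Star; ε; _◅_; _◅◅_)
open import Relation.Binary.Construct.Closure.Symmetric using (fwd; bwd)
open import Relation.Binary.Definitions using (tri<; tri≈; tri>)
open import Relation.Binary.PropositionalEquality using (_≡_; _≢_; refl; sym; trans; cong; cong₂; subst; subst₂)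
open import Relation.Nullary using (¬_; Dec; yes; no; contradiction; _×-dec_)
open import Relation.Nullary.Decidable using (map′)
open import Relation.Unary using (Decidable)

open Equivalence using (to; from)

private
  variable
    X Y : Set

-- Lookup in lists by position

nothing≢just : {x : X} {c : Maybe X} → c ≡ nothing → c ≢ just x
nothing≢just refl ()

unjust : {x y : X} {c : Maybe X} → c ≡ just x → c ≡ just y → x ≡ y
unjust p q = just-injective (trans (sym p) q)

nth-++ : ∀ (xs : List X) {ys m x} → nth xs m ≡ just x → nth (xs ++ ys) m ≡ just x
nth-++ []       {m = m}     ()
nth-++ (x ∷ xs) {m = zero}  eq = eq
nth-++ (x ∷ xs) {m = suc m} eq = nth-++ xs eq

nth-last : ∀ (xs : List X) {x} → nth (xs ++ [ x ]) (length xs) ≡ just x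
nth-last []       = refl
nth-last (_ ∷ xs) = nth-last xs

nth-snoc⁻ : ∀ (xs : List X) {y m x} → nth (xs ++ [ y ]) m ≡ just x
          → nth xs m ≡ just x ⊎ (m ≡ length xs × x ≡ y)
nth-snoc⁻ []       {m = zero}  refl = inj₂ (refl , refl)
nth-snoc⁻ []       {m = suc m} ()
nth-snoc⁻ (x ∷ xs) {m = zero}  eq   = inj₁ eq
nth-snoc⁻ (x ∷ xs) {m = suc m} eq   with nth-snoc⁻ xs eq
... | inj₁ p            = inj₁ p
... | inj₂ (refl , x≡y) = inj₂ (refl , x≡y)

nth-< : ∀ (xs : List X) {m x} → nth xs m ≡ just x → m < length xs
nth-< []       {m = m}     ()
nth-< (x ∷ xs) {m = zero}  eq = s≤s z≤n
nth-< (x ∷ xs) {m = suc m} eq = s≤s (nth-< xs eq)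

nth-snoc-< : ∀ (xs : List X) {y m x} → nth (xs ++ [ y ]) m ≡ just x → m < length xs
           → nth xs m ≡ just x
nth-snoc-< xs eq m< with nth-snoc⁻ xs eq
... | inj₁ p          = p
... | inj₂ (refl , _) = contradiction m< (<-irrefl refl)

nth-just : ∀ (xs : List X) {m} → m < length xs → ∃[ x ] nth xs m ≡ just x
nth-just (x ∷ xs) {zero}  _        = x , refl
nth-just (x ∷ xs) {suc m} (s≤s m<) = nth-just xs m<

nth-map : ∀ (f : X → Y) xs {m x} → nth xs m ≡ just x → nth (map f xs) m ≡ just (f x)
nth-map f []       {m = m}     ()
nth-map f (x ∷ xs) {m = zero}  refl = refl
nth-map f (x ∷ xs) {m = suc m} eq   = nth-map f xs eq

nth-map⁻ : ∀ (f : X → Y) xs {m y} → nth (map f xs) m ≡ just y → ∃[ x ] nth xs m ≡ just x × f x ≡ y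
nth-map⁻ f []       {m = m}     ()
nth-map⁻ f (x ∷ xs) {m = zero}  refl = x , refl , refl
nth-map⁻ f (x ∷ xs) {m = suc m} eq   = nth-map⁻ f xs eq

nth-any? : ∀ {P : X → Set} → Decidable P → ∀ xs → Dec (∃[ m ] ∃[ x ] (nth xs m ≡ just x × P x))
nth-any? P? []       = no λ { (_ , _ , () , _) }
nth-any? P? (x ∷ xs) with P? x | nth-any? P? xs
... | yes px | _                    = yes (zero , x , refl , px)
... | no ¬px | yes (m , y , eq , p) = yes (suc m , y , eq , p)
... | no ¬px | no ¬p                = no λ { (zero , _ , refl , p) → ¬px p
                                           ; (suc m , y , eq , p) → ¬p (m , y , eq , p) }

-- Finite codings

record Coding (X : Set) (_≈_ : X → X → Set) : Set where
  field
    size           : ℕ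
    code           : X → Fin size
    code-injective : ∀ {x y} → code x ≡ code y → x ≈ y
open Coding

Fin-coding : ∀ m → Coding (Fin m) _≡_
Fin-coding m = record { size = m ; code = λ x → x ; code-injective = λ eq → eq }

×-coding : ∀ {R : X → X → Set} {S : Y → Y → Set} → Coding X R → Coding Y S
         → Coding (X × Y) (λ p q → R (proj₁ p) (proj₁ q) × S (proj₂ p) (proj₂ q))
×-coding C D = record
  { size           = size C * size D
  ; code           = λ p → combine (code C (proj₁ p)) (code D (proj₂ p))
  ; code-injective = λ eq → let l , r = combine-injective _ _ _ _ eq in
                            code-injective C l , code-injective D r
  }

×-coding-≡ : Coding X _≡_ → Coding Y _≡_ → Coding (X × Y) _≡_
×-coding-≡ C D = record
  { size           = size (×-coding C D)
  ; code           = code (×-coding C D)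
  ; code-injective = λ eq → let l , r = code-injective (×-coding C D) eq in cong₂ _,_ l r
  }

Maybe-coding : Coding X _≡_ → Coding (Maybe X) _≡_
Maybe-coding C = record
  { size           = suc (size C)
  ; code           = maybe′ (suc ∘ code C) zero
  ; code-injective = λ { {just x}  {just y}  eq → cong just (code-injective C (sucᶠ-injective eq))
                       ; {nothing} {nothing} eq → refl }
  }

-- Equal codes of functions give only pointwise agreement, in the absence of extensionality; this is
-- why `Coding` carries a relation in place of equality.
Π-coding : ∀ {n} {Z : Fin n → Set} → (∀ j → Coding (Z j) _≡_)
         → Coding (∀ j → Z j) (λ g h → ∀ j → g j ≡ h j)
Π-coding {zero}  C = record { size = 1 ; code = λ _ → zero ; code-injective = λ _ () }
Π-coding {suc n} C = record
  { size           = size (C zero) * size tail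
  ; code           = λ g → combine (code (C zero) (g zero)) (code tail (g ∘ suc))
  ; code-injective = λ eq → let l , r = combine-injective _ _ _ _ eq in
      λ { zero → code-injective (C zero) l ; (suc j) → code-injective tail r j }
  }
  where tail = Π-coding (C ∘ suc)

-- The pigeonhole principle on the `size C + 1` values at the times from 0 to `size C`, whence the
-- bound on `q`.
repetition : ∀ {R : X → X → Set} (C : Coding X R) (f : ℕ → X)
           → ∃[ p ] ∃[ q ] (p < q × q ≤ size C × R (f p) (f q))
repetition C f with pigeonhole (n<1+n (size C)) (λ x → code C (f (toℕ x)))
... | p , q , p<q , eq = toℕ p , toℕ q , p<q , s≤s⁻¹ (toℕ<n q) , code-injective C eq

module Unfolding {k n : ℕ} (A : Fin n → FLTS k) (i : Fin n) where
  open Composition A i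

  infix 4 _≐_
  _≐_ : {Z : Fin n → Set} → (∀ j → Z j) → (∀ j → Z j) → Set
  g ≐ h = ∀ j → g j ≡ h j

  private
    variable
      g g′ g₁ g₂ : GS
      t : GT
      M M′ M₁ M₁′ M₂ : Marking
      ms ms′ ms₁ : List ℕ
      m x y : ℕ
      e e′ : Ev
      es : Events

  -- Global runs

  GStep-resp : g ≐ g₁ → g′ ≐ g₂ → GStep g t g′ → GStep g₁ t g₂
  GStep-resp {t = t} p q (v , s) =
    v , λ j → subst₂ (λ a b → LocStep a (loc t j) b) (p j) (q j) (s j)

  FinRun-resp : ∀ {ts} → g ≐ g′ → FinRun g ts → FinRun g′ ts
  FinRun-resp p []      = []
  FinRun-resp p (s ∷ r) = GStep-resp p (λ _ → refl) s ∷ r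

  interface-moves : ValidGT t → inI (act t) ≡ true → ∃[ l ] loc t i ≡ just l
  interface-moves {t} (_ , ok) a∈ with loc t i | ok i
  ... | just l  | _          = l , refl
  ... | nothing | nonpart a∉ = contradiction (trans (sym a∈) a∉) λ ()

  moves-interface : ∀ {l} → ValidGT t → loc t i ≡ just l → inI (act t) ≡ true
  moves-interface {t} (_ , ok) eq with loc t i | ok i
  moves-interface {t} (_ , ok) refl | just _ | part δ≡ = δ-alph (A i) _ _ _ δ≡

  stays-interface : ValidGT t → loc t i ≡ nothing → inI (act t) ≡ false
  stays-interface {t} (_ , ok) eq with loc t i | ok i
  stays-interface {t} (_ , ok) refl | nothing | nonpart a∉ = a∉

  some-moves : ValidGT t → ∃[ j ] ∃[ l ] loc t j ≡ just l
  some-moves {t} ((j , a∈) , ok) with loc t j in eq | ok j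
  ... | just l  | _          = j , l , eq
  ... | nothing | nonpart a∉ = contradiction (trans (sym a∈) a∉) λ ()

  -- The empty run is closed under pointwise equality because global states are functions, and
  -- endpoints computed from markings agree only pointwise.
  data Silent : GS → GS → Set where
    done : g ≐ g′ → Silent g g′
    walk : inI (act t) ≡ false → GStep g t g₁ → Silent g₁ g′ → Silent g g′

  silent-respˡ : g ≐ g₁ → Silent g g′ → Silent g₁ g′
  silent-respˡ p (done q)     = done λ j → trans (sym (p j)) (q j)
  silent-respˡ p (walk a s r) = walk a (GStep-resp p (λ _ → refl) s) r

  silent-++ : Silent g g₁ → Silent g₁ g′ → Silent g g′
  silent-++ (done p)     r = silent-respˡ (λ j → sym (p j)) r
  silent-++ (walk a s q) r = walk a s (silent-++ q r)

  silent-snoc : Silent g g₁ → inI (act t) ≡ false → GStep g₁ t g′ → Silent g g′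
  silent-snoc r a s = silent-++ r (walk a s (done λ _ → refl))

  locStep-moved : ∀ {j a b l s s′} → LocStep {j} a l b → l ≡ just (s , s′) → a ≡ s
  locStep-moved move refl = refl

  locStep-unique : ∀ {j a b b′ l l′} → LocStep {j} a l b → LocStep {j} a l′ b′ → l ≡ l′ → b ≡ b′
  locStep-unique stay stay refl = refl
  locStep-unique move move refl = refl

  silent-run : ∀ {ts} → Silent g g′ → FinRun g′ ts
             → ∃[ ts′ ] (FinRun g ts′ × projL (map act ts′) ≡ projL (map act ts))
  silent-run (done p) r = _ , FinRun-resp (λ j → sym (p j)) r , refl
  silent-run (walk {t = t} a s q) r with ts′ , r′ , eq ← silent-run q r =
    t ∷ ts′ , s ∷ r′ , trans (cong (if_then act t ∷ projL (map act ts′) else projL (map act ts′)) a) eq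

  -- Concatenating silent runs, each closed by an interface step, into one infinite run.
  module Concatenation (at mid : ℕ → GS) (t : ℕ → GT)
    (silent : ∀ l → Silent (at l) (mid l)) (steps : ∀ l → GStep (mid l) (t l) (at (suc l)))
    (visible : ∀ l → inI (act (t l)) ≡ true) where

    record Cursor : Set where
      constructor cursor
      field
        index : ℕ
        now : GS
        rest  : Silent now (mid index)
    open Cursor

    next : Cursor → Cursor
    next (cursor l g (done _))     = cursor (suc l) (at (suc l)) (silent (suc l))
    next (cursor l g (walk _ _ r)) = cursor l _ r

    emit : Cursor → GT
    emit (cursor l g (done _))             = t l
    emit (cursor l g (walk {t = t′} _ _ _)) = t′

    emit-step : ∀ z → GStep (now z) (emit z) (now (next z))
    emit-step (cursor l g (done p))     = GStep-resp (λ j → sym (p j)) (λ _ → refl) (steps l)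
    emit-step (cursor l g (walk _ s _)) = s

    len : Silent g g′ → ℕ
    len (done _)     = 0
    len (walk _ _ r) = suc (len r)

    time : ℕ → Cursor
    time zero    = cursor 0 (at 0) (silent 0)
    time (suc m) = next (time m)

    -- The time at which `t l` is emitted: it is preceded by the silent steps of the segments up to
    -- `l` and by `l` interface steps.
    f : ℕ → ℕ
    f zero    = len (silent 0)
    f (suc l) = suc (f l + len (silent (suc l)))

    -- The invariant: elapsed time plus remaining silent steps equals the time of the next interface
    -- step. A silent step trades one remaining step for one unit of time; an interface step sets
    -- the next target.
    next-timing : ∀ z {m} → m + len (rest z) ≡ f (index z) → suc m + len (rest (next z)) ≡ f (index (next z))
    next-timing (cursor l g (done _)) {m} eq =
      cong (λ x → suc (x + len (silent (suc l)))) (trans (sym (+-identityʳ m)) eq)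
    next-timing (cursor l g (walk _ _ r)) {m} eq = trans (sym (+-suc m (len r))) eq

    timing : ∀ m → m + len (rest (time m)) ≡ f (index (time m))
    timing zero    = refl
    timing (suc m) = next-timing (time m) (timing m)

    visible-rest : ∀ z → inI (act (emit z)) ≡ true → len (rest z) ≡ 0
    visible-rest (cursor l g (done _))     _  = refl
    visible-rest (cursor l g (walk a _ _)) a∈ = contradiction (trans (sym a) a∈) λ ()

    -- Every tick shortens the silent run that is left, so recursion on that run reaches the moment
    -- at which `t l` is due.
    finish : ∀ m {l g} (r : Silent g (mid l)) → time m ≡ cursor l g r
           → ∃[ m′ ] ∃[ g′ ] ∃[ p ] time m′ ≡ cursor l g′ (done p)
    finish m (done p)     eq = m , _ , p , eq
    finish m (walk _ _ r) eq = finish (suc m) r (cong next eq)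

    arrive : ∀ l → ∃[ m ] ∃[ g ] ∃[ p ] time m ≡ cursor l g (done p)
    arrive zero    = finish 0 (silent 0) refl
    arrive (suc l) = let m , _ , _ , eq = arrive l in finish (suc m) (silent (suc l)) (cong next eq)

    emit-f : ∀ l → act (emit (time (f l))) ≡ act (t l)
    emit-f l with m , g , p , eq ← arrive l =
      trans (cong (act ∘ emit ∘ time) (sym m≡f)) (cong (act ∘ emit) eq)
      where
      m≡f : m ≡ f l
      m≡f = trans (sym (+-identityʳ m))
                  (subst (λ z → m + len (rest z) ≡ f (index z)) eq (timing m))

    projInf : ∀ {u} → at 0 ≐ gs0 → (∀ l → u l ≡ act (t l)) → ProjInf u
    projInf start u≡ =
      (act ∘ emit ∘ time) ,
      (emit ∘ time , now ∘ time , start , emit-step ∘ time , λ _ → refl) ,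
      f , (λ l → s≤s (m≤m+n (f l) _)) , (λ l → trans (cong inI (emit-f l)) (visible l)) ,
      (λ l → trans (emit-f l) (sym (u≡ l))) ,
      -- When the emitted action is visible no silent steps remain, and the timing invariant says
      -- that `m` is a value of `f`.
      λ m a∈ → index (time m) ,
        trans (sym (timing m)) (trans (cong (m +_) (visible-rest (time m) a∈)) (+-identityʳ m))

  -- Going round the segment from p to q forever yields a diverging trace.
  lasso : (gs : ℕ → GS) (p q : ℕ) → p < q → gs 0 ≐ gs0 → gs q ≐ gs p
        → (∀ x → x < q → ∃[ t ] GStep (gs x) t (gs (suc x)) × (p ≤ x → inI (act t) ≡ false))
        → Divergent
  lasso gs p q p<q start loop steps =
    (act ∘ ts) ,
    (ts , gs ∘ pos , start , (λ m → proj₁ (proj₂ (follow (pos m) (pos<q m)))) , λ _ → refl) ,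
    p , λ m p≤m → proj₂ (proj₂ (follow (pos m) (pos<q m))) (p≤pos m p≤m)
    where
    next : ℕ → ℕ
    next x with suc x ≟ q
    ... | yes _ = p
    ... | no  _ = suc x

    pos : ℕ → ℕ
    pos zero    = zero
    pos (suc m) = next (pos m)

    next<q : ∀ x → x < q → next x < q
    next<q x x<q with suc x ≟ q
    ... | yes _   = p<q
    ... | no  1+x≢q = ≤∧≢⇒< x<q 1+x≢q

    pos<q : ∀ m → pos m < q
    pos<q zero    = ≤-<-trans z≤n p<q
    pos<q (suc m) = next<q (pos m) (pos<q m)

    follow : ∀ x → x < q → ∃[ t ] GStep (gs x) t (gs (next x)) × (p ≤ x → inI (act t) ≡ false)
    follow x x<q with suc x ≟ q
    ... | no  _    = steps x x<q
    -- The last step before `q` is redirected to `gs p`, which agrees with `gs q`.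
    ... | yes refl = let t , s , quiet = steps x x<q in t , GStep-resp (λ _ → refl) loop s , quiet

    ts : ℕ → GT
    ts m = proj₁ (follow (pos m) (pos<q m))

    p≤next : ∀ x → p ≤ x → p ≤ next x
    p≤next x p≤x with suc x ≟ q
    ... | yes _ = ≤-refl
    ... | no  _ = ≤-trans p≤x (n≤1+n x)

    next-step : ∀ x → x < p → next x ≡ suc x
    next-step x x<p with suc x ≟ q
    ... | yes refl = contradiction (≤-<-trans x<p p<q) (<-irrefl refl)
    ... | no  _    = refl

    pos-id : ∀ m → m ≤ p → pos m ≡ m
    pos-id zero    _   = refl
    pos-id (suc m) m<p = trans (cong next (pos-id m (<⇒≤ m<p))) (next-step m m<p)

    -- Up to time `p` position and time coincide, and `next` never leads from the loop to a position
    -- below `p`.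
    p≤pos : ∀ m → p ≤ m → p ≤ pos m
    p≤pos m p≤m with m≤n⇒m<n∨m≡n p≤m
    ... | inj₂ refl = ≤-reflexive (sym (pos-id p ≤-refl))
    p≤pos (suc m) p≤m | inj₁ (s≤s p≤m′) = p≤next (pos m) (p≤pos m p≤m′)

  -- Occurrence sequences

  module Net (es : Events) where

    Moves : ℕ → Fin n → Set
    Moves m j = ∃[ e ] ∃[ l ] (nth es m ≡ just e × loc (gt e) j ≡ just l)

    Consumes : ℕ → Fin n → Maybe ℕ → Set
    Consumes m j c = ∃[ e ] ∃[ l ] (nth es m ≡ just e × loc (gt e) j ≡ just l × pre e j ≡ c)

    -- The conditions that have been created once the events `ms` have fired, whether or not they
    -- have been consumed since.
    data Present (ms : List ℕ) (j : Fin n) : Maybe ℕ → Set where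
      initial : Present ms j nothing
      output  : m ∈ ms → Moves m j → Present ms j (just m)

    -- The list holds the fired events, most recent first.
    data Seg (M : Marking) : List ℕ → Marking → Set where
      start : M ≐ M′ → Seg M [] M′
      _▷_   : Seg M ms M₁ → Fire es M₁ m M′ → Seg M (m ∷ ms) M′

    present-mono : ∀ {j c} → (∀ {x} → x ∈ ms → x ∈ ms′) → Present ms j c → Present ms′ j c
    present-mono ⊆ initial        = initial
    present-mono ⊆ (output m∈ mv) = output (⊆ m∈) mv

    mkFire : nth es m ≡ just e
           → (∀ j {l} → loc (gt e) j ≡ just l → pre e j ≡ M j × M′ j ≡ just m)
           → (∀ j → loc (gt e) j ≡ nothing → M′ j ≡ M j)
           → Fire es M m M′
    mkFire {m = m} {e = e} {M = M} {M′ = M′} eq mv st = e , eq , λ j → go j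
      where
      go : ∀ j → FireLoc m (loc (gt e) j) (pre e j) (M j) (M′ j)
      go j with loc (gt e) j | mv j | st j
      ... | just l  | mvj | _ with p , q ← mvj refl rewrite p | q = fmove
      ... | nothing | _ | stj rewrite stj refl = fstay

    fire-moved : ∀ {j l} → Fire es M m M′ → nth es m ≡ just e → loc (gt e) j ≡ just l
               → pre e j ≡ M j × M′ j ≡ just m
    fire-moved {m = m} {j = j} (_ , eq₁ , f) eq lj with refl ← unjust eq₁ eq = go (f j) lj
      where
      go : ∀ {o p c c′ l} → FireLoc m {j} o p c c′ → o ≡ just l → p ≡ c × c′ ≡ just m
      go fmove refl = refl , refl

    fire-kept : ∀ {j} → Fire es M m M′ → nth es m ≡ just e → loc (gt e) j ≡ nothing → M′ j ≡ M j
    fire-kept {m = m} {j = j} (_ , eq₁ , f) eq lj with refl ← unjust eq₁ eq = go (f j) lj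
      where
      go : ∀ {o p c c′} → FireLoc m {j} o p c c′ → o ≡ nothing → c′ ≡ c
      go fstay refl = refl

    fire-cases : ∀ j → Fire es M m M′
               → (Consumes m j (M j) × M′ j ≡ just m) ⊎ (¬ Moves m j × M′ j ≡ M j)
    fire-cases j f@(e , eq , _) with loc (gt e) j in lj
    ... | just l  = let p , q = fire-moved f eq lj in inj₁ ((e , l , eq , lj , p) , q)
    ... | nothing = inj₂ ( (λ (e′ , l , eq′ , lj′) →
                              nothing≢just (subst (λ z → loc (gt z) j ≡ nothing) (unjust eq eq′) lj) lj′)
                         , fire-kept f eq lj )

    fire-respˡ : M ≐ M₁ → Fire es M m M′ → Fire es M₁ m M′
    fire-respˡ {m = m} {M′ = M′} p (e , eq , f) =
      e , eq , λ j → subst (λ c → FireLoc m (loc (gt e) j) (pre e j) c (M′ j)) (p j) (f j)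

    consumes⇒moves : ∀ {j c} → Consumes m j c → Moves m j
    consumes⇒moves (e , l , eq , lj , _) = e , l , eq , lj

    consumes-fired : ∀ {j c} → Fire es M m M′ → Consumes m j c → c ≡ M j
    consumes-fired f (e , l , eq , lj , p) = trans (sym p) (proj₁ (fire-moved f eq lj))

    -- Together the fields make the marked j-condition the only one that is created and not
    -- consumed, so that it depends only on the set of fired events.
    record Inv (ms : List ℕ) (M : Marking) : Set where
      field
        present    : ∀ j → Present ms j (M j)
        unconsumed : ∀ {j x} → x ∈ ms → ¬ Consumes x j (M j)
        current    : ∀ {j c} → Present ms j c → M j ≡ c ⊎ (∃[ x ] x ∈ ms × Consumes x j c)
        closed     : ∀ {j c x} → x ∈ ms → Consumes x j c → Present ms j c
    open Inv

    inv-fire : Inv ms M → Fire es M m M′ → Inv (m ∷ ms) M′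
    inv-fire {ms} {M} {m} {M′} I F = record
      { present = present′ ; unconsumed = unconsumed′ ; current = current′ ; closed = closed′ }
      where
      -- No event fires twice: it consumes a condition in some component, and a second firing would
      -- find that condition marked again.
      fresh : ¬ m ∈ ms
      fresh m∈ = let e , eq , _ = F ; _ , l , lj = some-moves (valid e) in
        unconsumed I m∈ (e , l , eq , lj , proj₁ (fire-moved F eq lj))

      present′ : ∀ j → Present (m ∷ ms) j (M′ j)
      present′ j with fire-cases j F
      ... | inj₁ (c , q) rewrite q = output (here refl) (consumes⇒moves c)
      ... | inj₂ (_ , q) rewrite q = present-mono there (present I j)

      unmade : ∀ {j} → ¬ Present ms j (just m)
      unmade (output m∈ _) = fresh m∈

      unconsumed′ : ∀ {j x} → x ∈ m ∷ ms → ¬ Consumes x j (M′ j)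
      unconsumed′ {j} x∈ c with fire-cases j F
      unconsumed′ {j} (here refl) c | inj₁ (_ , q) =
        unmade (subst (Present ms j) (trans (sym (consumes-fired F c)) q) (present I j))
      unconsumed′ {j} (there x∈) c | inj₁ (_ , q) =
        unmade (subst (Present ms j) q (closed I x∈ c))
      unconsumed′ {j} (here refl) c | inj₂ (¬mv , q) = ¬mv (consumes⇒moves c)
      unconsumed′ {j} (there x∈) c | inj₂ (¬mv , q) = unconsumed I x∈ (subst (Consumes _ j) q c)

      old : ∀ {j c} → Present ms j c → M′ j ≡ c ⊎ (∃[ x ] x ∈ m ∷ ms × Consumes x j c)
      old {j} p with current I p | fire-cases j F
      ... | inj₂ (x , x∈ , c) | _ = inj₂ (x , there x∈ , c)
      ... | inj₁ refl | inj₁ (c , _) = inj₂ (m , here refl , c)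
      ... | inj₁ refl | inj₂ (_ , q) = inj₁ q

      current′ : ∀ {j c} → Present (m ∷ ms) j c → M′ j ≡ c ⊎ (∃[ x ] x ∈ m ∷ ms × Consumes x j c)
      current′ initial = old initial
      current′ (output (there x∈) mv) = old (output x∈ mv)
      current′ (output (here refl) (e , l , eq , lj)) = inj₁ (proj₂ (fire-moved F eq lj))

      closed′ : ∀ {j c x} → x ∈ m ∷ ms → Consumes x j c → Present (m ∷ ms) j c
      closed′ {j} (here refl) c =
        subst (Present _ j) (sym (consumes-fired F c)) (present-mono there (present I j))
      closed′ (there x∈) c = present-mono there (closed I x∈ c)

    seg-inv : Seg M0 ms M → Inv ms M
    seg-inv (start p) = record
      { present    = λ j → subst (Present [] j) (p j) initial
      ; unconsumed = λ ()
      ; current    = λ { {j} initial → inj₁ (sym (p j)) ; (output () _) }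
      ; closed     = λ ()
      }
    seg-inv (s ▷ f) = inv-fire (seg-inv s) f

    -- If the smaller set `ms′` had consumed the condition, the consuming event would also belong to
    -- `ms`, after which the condition is still marked.
    agree : ∀ {j} → Seg M0 ms M → Seg M0 ms′ M′ → (∀ {x} → x ∈ ms′ → x ∈ ms)
          → Present ms′ j (M j) → M′ j ≡ M j
    agree s s′ ⊆ p with current (seg-inv s′) p
    ... | inj₁ q            = q
    ... | inj₂ (x , x∈ , c) = contradiction c (unconsumed (seg-inv s) (⊆ x∈))

    seg-unique : Seg M0 ms M → Seg M0 ms′ M′ → (∀ {x} → x ∈ ms → x ∈ ms′)
               → (∀ {x} → x ∈ ms′ → x ∈ ms) → M ≐ M′
    seg-unique s s′ ⊆ ⊇ j = sym (agree s s′ ⊇ (present-mono ⊆ (present (seg-inv s) j)))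

    seg-++ : Seg M ms M₁ → Seg M₁ ms′ M′ → Seg M (ms′ ++ ms) M′
    seg-++ (start p) (start q) = start λ j → trans (p j) (q j)
    seg-++ (s ▷ f)   (start q) = s ▷ fire-respʳ q f
      where
      fire-respʳ : M₁ ≐ M₁′ → Fire es M m M₁ → Fire es M m M₁′
      fire-respʳ {M = M} {m = m} p (e , eq , f) =
        e , eq , λ j → subst (FireLoc m (loc (gt e) j) (pre e j) (M j)) (p j) (f j)
    seg-++ s (s′ ▷ f) = seg-++ s s′ ▷ f

    -- The first event of the segment that moves component `j` consumes the j-condition marked at
    -- the start.
    moved⊎unmoved : ∀ j → Seg M ms M′
      → (∃[ x ] x ∈ ms × Consumes x j (M j)) ⊎ ((∀ {x} → x ∈ ms → ¬ Moves x j) × M′ j ≡ M j)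
    moved⊎unmoved j (start p) = inj₂ ((λ ()) , sym (p j))
    moved⊎unmoved j (s ▷ f) with moved⊎unmoved j s | fire-cases j f
    ... | inj₁ (x , x∈ , c) | _             = inj₁ (x , there x∈ , c)
    ... | inj₂ (¬mv , q)    | inj₁ (c , _)  = inj₁ (_ , here refl , subst (Consumes _ j) q c)
    ... | inj₂ (¬mv , q)    | inj₂ (¬m , r) =
      inj₂ ((λ { (here refl) → ¬m ; (there x∈) → ¬mv x∈ }) , trans r q)

    -- An event moving `j` would force the j-condition of `M` to be consumed, yet it is marked at
    -- the end. Silence of a segment is always derived in this way, from equal i-conditions at its
    -- ends.
    unmoved : ∀ {j} → Seg M0 ms M → Seg M ms′ M′ → M j ≡ M′ j → ∀ {x} → x ∈ ms′ → ¬ Moves x j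
    unmoved {j = j} s s′ q with moved⊎unmoved j s′
    ... | inj₂ (¬mv , _)    = ¬mv
    ... | inj₁ (x , x∈ , c) =
      contradiction (subst (Consumes x j) q c) (unconsumed (seg-inv (seg-++ s s′)) (∈-++⁺ˡ x∈))

    -- Postponing the events outside a causally closed set

    after-fire : ℕ → Ev → Marking → Marking
    after-fire m e M j = maybe′ (λ _ → just m) (M j) (loc (gt e) j)

    fire-enabled : nth es m ≡ just e → (∀ j {l} → loc (gt e) j ≡ just l → pre e j ≡ M j)
                 → Fire es M m (after-fire m e M)
    fire-enabled {m = m} {e = e} {M = M} eq en =
      mkFire eq (λ j lj → en j lj , cong (maybe′ (λ _ → just m) (M j)) lj)
                (λ j lj → cong (maybe′ (λ _ → just m) (M j)) lj)

    -- Events without a common component commute. Since `m` is enabled at both ends of the segment,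
    -- it can be moved to the front, passing the last event of the segment first.
    slide : Seg M ms M₁ → (∀ {x} → x ∈ ms → ∀ {j} → Moves m j → ¬ Moves x j)
          → Fire es M m M′ → Fire es M₁ m M₁′ → Seg M′ ms M₁′
    slide {M′ = M′} {M₁′ = M₁′} (start p) _ f@(e , eq , _) f₁ = start same
      where
      same : M′ ≐ M₁′
      same j with loc (gt e) j in lj
      ... | just _  = trans (proj₂ (fire-moved f eq lj)) (sym (proj₂ (fire-moved f₁ eq lj)))
      ... | nothing = trans (fire-kept f eq lj) (trans (p j) (sym (fire-kept f₁ eq lj)))
    slide {m = m} {M₁′ = M₁′} (_▷_ {M₁ = M₂} {m = r} {M′ = M₁} s fr@(er , eqr , _)) disjoint f f₁@(e , eq , _) =
      slide s (λ x∈ → disjoint (there x∈)) f f₂ ▷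
        mkFire eqr (λ j lr → trans (proj₁ (fire-moved fr eqr lr)) (sym (kept j (still j lr)))
                           , trans (fire-kept f₁ eq (still j lr)) (proj₂ (fire-moved fr eqr lr)))
                   rest
      where
      f₂ : Fire es M₂ m (after-fire m e M₂)
      f₂ = fire-enabled eq λ j le → trans (proj₁ (fire-moved f₁ eq le)) (unmoved-by j le)
        where
        unmoved-by : ∀ j {l} → loc (gt e) j ≡ just l → M₁ j ≡ M₂ j
        unmoved-by j le with fire-cases j fr
        ... | inj₁ (c , _) = contradiction (consumes⇒moves c) (disjoint (here refl) (e , _ , eq , le))
        ... | inj₂ (_ , q) = q
      kept : ∀ j → loc (gt e) j ≡ nothing → after-fire m e M₂ j ≡ M₂ j
      kept j le = fire-kept f₂ eq le
      still : ∀ j {l} → loc (gt er) j ≡ just l → loc (gt e) j ≡ nothing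
      still j lr with loc (gt e) j in le
      ... | nothing = refl
      ... | just _  = contradiction (er , _ , eqr , lr) (disjoint (here refl) (e , _ , eq , le))
      rest : ∀ j → loc (gt er) j ≡ nothing → M₁′ j ≡ after-fire m e M₂ j
      rest j lr with loc (gt e) j in le
      ... | just _  = proj₂ (fire-moved f₁ eq le)
      ... | nothing = trans (fire-kept f₁ eq le) (fire-kept fr eqr lr)

    DownClosed : (ℕ → Set) → Set
    DownClosed D = ∀ {x y e j} → nth es x ≡ just e → pre e j ≡ just y → D x → D y

    -- The condition is initial or produced by an event of `D`, so the restricted sequence creates
    -- it as well and `agree` applies.
    restrict-agree : ∀ {D : ℕ → Set} (D? : Decidable D) {j} → Seg M0 ms M
                   → Seg M0 (filter D? ms) M₁ → (∀ {y} → M j ≡ just y → D y) → M₁ j ≡ M j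
    restrict-agree {ms} {M} D? {j} s s₁ d = agree s s₁ (proj₁ ∘ ∈-filter⁻ D?) (kept (present (seg-inv s) j) d)
      where
      kept : ∀ {c} → Present ms j c → (∀ {y} → c ≡ just y → _) → Present (filter D? ms) j c
      kept initial        _ = initial
      kept (output m∈ mv) d = output (∈-filter⁺ D? m∈ (d refl)) mv

    -- The producers of the inputs of an event in `D` lie in `D`, so these inputs are marked right
    -- after the `D`-part. The postponed events therefore leave the components of this event alone,
    -- and `slide` moves it in front of them.
    split : ∀ {D : ℕ → Set} (D? : Decidable D) → DownClosed D → Seg M0 ms M
          → ∃[ M₁ ] ∃[ ms₂ ] (Seg M0 (filter D? ms) M₁ × Seg M₁ ms₂ M)
    split {ms = []} D? dc s@(start _) = _ , [] , s , start λ _ → refl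
    split {ms = m ∷ ms} {M = M′} D? dc (_▷_ {M₁ = M} s f@(e , eq , _)) with M₁ , ms₂ , s₁ , s₂ ← split D? dc s with D? m
    ... | no  _  = M₁ , m ∷ ms₂ , s₁ , s₂ ▷ f
    ... | yes dm = after-fire m e M₁ , ms₂ , s₁ ▷ f₁ , slide s₂ disjoint f₁ f
      where
      same : ∀ j {l} → loc (gt e) j ≡ just l → M₁ j ≡ M j
      same j lj = restrict-agree D? s s₁ λ q → dc eq (trans (proj₁ (fire-moved f eq lj)) q) dm
      f₁ : Fire es M₁ m (after-fire m e M₁)
      f₁ = fire-enabled eq λ j lj → trans (proj₁ (fire-moved f eq lj)) (sym (same j lj))
      disjoint : ∀ {x} → x ∈ ms₂ → ∀ {j} → Moves m j → ¬ Moves x j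
      disjoint x∈ {j} (e′ , l , eq′ , lj) with refl ← unjust eq eq′ = unmoved s₁ s₂ (same j lj) x∈

    -- Segments as occurrence sequences and as sequences indexed by time

    seg→occ : Seg M0 ms M → ∃[ M′ ] ∃[ ms′ ] (M′ ≐ M × Occ es M0 ms′ M′ × (∀ x → x ∈ ms′ ⇔ x ∈ ms))
    seg→occ (start p) = M0 , [] , p , [] , λ _ → mk⇔ (λ z → z) (λ z → z)
    seg→occ {ms = m ∷ ms} {M = M} (s ▷ f) with M₁ , ms′ , p , o , ⇔ms ← seg→occ s =
      M , ms′ ++ [ m ] , (λ _ → refl) , occ-snoc o (fire-respˡ (λ j → sym (p j)) f) ,
      λ x → mk⇔ (fwd′ x) λ { (here refl) → ∈-++⁺ʳ ms′ (here refl)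
                           ; (there x∈)  → ∈-++⁺ˡ (from (⇔ms x) x∈) }
      where
      occ-snoc : ∀ {M M₁ M′ ms m} → Occ es M ms M₁ → Fire es M₁ m M′ → Occ es M (ms ++ [ m ]) M′
      occ-snoc []      f = f ∷ []
      occ-snoc (h ∷ o) f = h ∷ occ-snoc o f
      fwd′ : ∀ x → x ∈ ms′ ++ [ m ] → x ∈ m ∷ ms
      fwd′ x x∈ with ∈-++⁻ ms′ x∈
      ... | inj₁ y           = there (to (⇔ms x) y)
      ... | inj₂ (here refl) = here refl

    occ→seg : Seg M0 ms M → Occ es M ms₁ M′
            → ∃[ ms′ ] (Seg M0 ms′ M′ × (∀ x → x ∈ ms′ ⇔ (x ∈ ms ⊎ x ∈ ms₁)))
    occ→seg {ms = ms} s [] = ms , s , λ x → mk⇔ inj₁ λ { (inj₁ x∈) → x∈ ; (inj₂ ()) }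
    occ→seg s (f ∷ o) with ms′ , s′ , ⇔ms ← occ→seg (s ▷ f) o =
      ms′ , s′ , λ x → mk⇔ (λ x∈ → case to (⇔ms x) x∈ of λ
                             { (inj₁ (here p)) → inj₂ (here p)
                             ; (inj₁ (there z)) → inj₁ z
                             ; (inj₂ z) → inj₂ (there z) })
                           λ { (inj₁ z) → from (⇔ms x) (inj₁ (there z))
                             ; (inj₂ (here p)) → from (⇔ms x) (inj₁ (here p))
                             ; (inj₂ (there z)) → from (⇔ms x) (inj₂ z) }

    collect : ∀ {P : ℕ → Set} (mk : ℕ → Marking) (f : ℕ → ℕ) {p q}
            → (∀ x → x < q → Fire es (mk x) (f x) (mk (suc x)) × P (f x)) → p ≤′ q
            → ∃[ ms ] (Seg (mk p) ms (mk q) × (∀ {y} → y ∈ ms → P y) × (∀ x → p ≤ x → x < q → f x ∈ ms))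
    collect mk f fires ≤′-refl = [] , start (λ _ → refl) , (λ ()) , λ x p≤x x<p → contradiction p≤x (<⇒≱ x<p)
    collect {P} mk f {p} fires (≤′-step {q} p≤q)
      with ms , s , all , has ← collect {P} mk f (λ x x<q → fires x (m<n⇒m<1+n x<q)) p≤q =
      f q ∷ ms , s ▷ proj₁ (fires q ≤-refl) ,
      (λ { (here refl) → proj₂ (fires q ≤-refl) ; (there y∈) → all y∈ }) , has′
      where
      has′ : ∀ x → p ≤ x → x < suc q → f x ∈ f q ∷ ms
      has′ x p≤x x≤q with m<1+n⇒m<n∨m≡n x≤q
      ... | inj₁ x<q  = there (has x p≤x x<q)
      ... | inj₂ refl = here refl

    -- Indices count backwards from the end of the sequence.
    rewound : Seg M ms M′ → ℕ → Marking
    rewound {M′ = M′} s         zero    = M′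
    rewound {M = M}   (start _) (suc y) = M
    rewound           (s ▷ _)   (suc y) = rewound s y

    rewound-event : Seg M ms M′ → ℕ → ℕ
    rewound-event (start _)       _       = 0
    rewound-event (_▷_ {m = m} _ _) zero  = m
    rewound-event (s ▷ _)         (suc y) = rewound-event s y

    rewound-start : (s : Seg M ms M′) → M ≐ rewound s (length ms)
    rewound-start (start p) = p
    rewound-start (s ▷ _)   = rewound-start s

    rewound-fires : (s : Seg M ms M′) → ∀ y → y < length ms
                  → Fire es (rewound s (suc y)) (rewound-event s y) (rewound s y) × rewound-event s y ∈ ms
    rewound-fires (s ▷ f) zero    _  = f , here refl
    rewound-fires (s ▷ f) (suc y) y< = let h , x∈ = rewound-fires s y (s≤s⁻¹ y<) in h , there x∈

    -- Indexing by time from the start is the form in which the pigeonhole principle can pick two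
    -- moments of a sequence.
    forward : Seg M ms M′ → Σ (ℕ → Marking) λ mk → Σ (ℕ → ℕ) λ f →
              M ≐ mk 0 × (∀ x → x < length ms → Fire es (mk x) (f x) (mk (suc x)) × f x ∈ ms)
    forward {ms = ms} s = mk , f , rewound-start s , fires
      where
      mk : ℕ → Marking
      mk x = rewound s (length ms ∸ x)
      f : ℕ → ℕ
      f x = rewound-event s (length ms ∸ suc x)
      fires : ∀ x → x < length ms → Fire es (mk x) (f x) (mk (suc x)) × f x ∈ ms
      fires x x< = subst (λ z → Fire es (rewound s z) (f x) (mk (suc x)) × f x ∈ ms) (sym (+-∸-assoc 1 x<))
                         (rewound-fires s (length ms ∸ suc x) (∸-monoʳ-< (s≤s z≤n) x<))

    -- The default s0 is only reached at conditions that do not exist.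
    lab : ∀ j → Maybe ℕ → Fin (nS (A j))
    lab j nothing  = s0 (A j)
    lab j (just m) = maybe′ (λ e → maybe′ proj₂ (s0 (A j)) (loc (gt e) j)) (s0 (A j)) (nth es m)

    state : Marking → GS
    state M j = lab j (M j)

    lab-out : ∀ {j s s′} → nth es m ≡ just e → loc (gt e) j ≡ just (s , s′) → lab j (just m) ≡ s′
    lab-out eq lj rewrite eq | lj = refl

    condLab-lab : ∀ {j c s} → CondLab es j c s → lab j c ≡ s
    condLab-lab init        = refl
    condLab-lab (out eq lj) = lab-out eq lj

    present-condLab : ∀ {j c} → Present ms j c → CondLab es j c (lab j c)
    present-condLab initial = init
    present-condLab (output _ (_ , _ , eq , lj)) = subst (CondLab es _ _) (sym (lab-out eq lj)) (out eq lj)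

    -- An upper bound only: every causal chain ending in the event has at most `d` members.
    data Depth : ℕ → ℕ → Set where
      deeper : ∀ {d} → nth es m ≡ just e → (∀ {j x} → pre e j ≡ just x → Depth d x) → Depth (suc d) m

    depth-suc : ∀ {d} → Depth d m → Depth (suc d) m
    depth-suc (deeper eq h) = deeper eq λ p → depth-suc (h p)

    depth-≤ : ∀ {d d′} → d ≤ d′ → Depth d m → Depth d′ m
    depth-≤ (s≤s d≤) (deeper eq h) = deeper eq λ p → depth-≤ d≤ (h p)

    -- The properties of branching processes on which the argument rests. `enabled` asks for any
    -- sequence that marks the preset; `local` later trims it to the strict past.
    record WF : Set where
      field
        pre-<       : ∀ {j} → nth es m ≡ just e → pre e j ≡ just x → x < m
        pre-⋆       : ∀ {j} → nth es m ≡ just e → loc (gt e) j ≡ nothing → pre e j ≡ nothing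
        pre-lab     : ∀ {j s s′} → nth es m ≡ just e → loc (gt e) j ≡ just (s , s′) → CondLab es j (pre e j) s
        no-repeat   : nth es m ≡ just e → nth es x ≡ just e′ → SameEv e e′ → m ≡ x
        enabled     : nth es m ≡ just e
                    → ∃[ ms ] ∃[ M ] (Seg M0 ms M × (∀ j {l} → loc (gt e) j ≡ just l → pre e j ≡ M j))

    -- Causal pasts and the states of events

    past-downClosed : DownClosed (λ x → Past es x m)
    past-downClosed eq q here           = back eq q here
    past-downClosed eq q (back eq′ r b) = back eq′ r (past-downClosed eq q b)

    before-downClosed : ∀ {p} → DownClosed (Before es p)
    before-downClosed eq q (j , m , r , b) = j , m , r , past-downClosed eq q b

    past-cases : nth es m ≡ just e → Past es x m → x ≡ m ⊎ Before es (pre e) x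
    past-cases eq here           = inj₁ refl
    past-cases eq (back eq′ q b) with refl ← unjust eq eq′ = inj₂ (_ , _ , q , b)

    before-past : nth es m ≡ just e → Before es (pre e) x → Past es x m
    before-past eq (_ , _ , q , b) = back eq q b

    module WellFormed (wf : WF) where
      open WF wf

      past-≤ : Past es x m → x ≤ m
      past-≤ here          = ≤-refl
      past-≤ (back eq q b) = ≤-trans (past-≤ b) (<⇒≤ (pre-< eq q))

      -- Producers of inputs have smaller indices, so a search with fuel `suc m` is exhaustive.
      past? : ∀ x m → Dec (Past es x m)
      past? x m = go (suc m) m ≤-refl
        where
        go : ∀ fuel m → m < fuel → Dec (Past es x m)
        go (suc fuel) m (s≤s m≤) with x ≟ m
        ... | yes refl = yes here
        ... | no  x≢m with nth es m in eq
        ... | nothing = no λ { here → x≢m refl ; (back eq′ _ _) → nothing≢just eq eq′ }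
        ... | just e  = map′ (λ (j , y , q , b) → back eq q b)
                             (λ { here → contradiction refl x≢m
                                ; (back eq′ q b) → _ , _ , trans (cong (λ z → pre z _) (unjust eq eq′)) q , b })
                             (any? via)
          where
          via : ∀ j → Dec (∃[ y ] (pre e j ≡ just y × Past es x y))
          via j with pre e j in q
          ... | nothing = no λ ()
          ... | just y  = map′ (λ b → y , refl , b) (λ { (_ , refl , b) → b })
                               (go fuel y (<-≤-trans (pre-< eq q) m≤))

      before? : ∀ p x → Dec (Before es p x)
      before? p x = any? via
        where
        via : ∀ j → Dec (∃[ y ] (p j ≡ just y × Past es x y))
        via j with p j
        ... | nothing = no λ ()
        ... | just y  = map′ (λ b → y , refl , b) (λ { (_ , refl , b) → b }) (past? x y)

      pre-moves : ∀ {j} → nth es m ≡ just e → pre e j ≡ just x → ∃[ l ] loc (gt e) j ≡ just l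
      pre-moves {e = e} {j = j} eq q with loc (gt e) j in lj
      ... | just l  = l , refl
      ... | nothing = contradiction q (nothing≢just (pre-⋆ eq lj))

      -- This iterates the field `closed` of the invariant along the causal chain.
      seg-past : Seg M0 ms M → x ∈ ms → Past es y x → y ∈ ms
      seg-past s x∈ here = x∈
      seg-past s x∈ (back eq q b) with l , lj ← pre-moves eq q
        with output y∈ _ ← closed (seg-inv s) x∈ (_ , l , eq , lj , q) = seg-past s y∈ b

      seg-marked : ∀ {j} → Seg M0 ms M → M j ≡ just x → x ∈ ms × Moves x j
      seg-marked {j = j} s q with output x∈ mv ← subst (Present _ j) q (present (seg-inv s) j) = x∈ , mv

      -- The inputs of the last event come from events fired earlier, so each firing adds at most
      -- one to the depth.
      seg-depth : Seg M0 ms M → x ∈ ms → Depth (length ms) x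
      seg-depth (s ▷ f@(e , eq , _)) (here refl) = deeper eq λ q →
        let l , lj = pre-moves eq q in
        seg-depth s (proj₁ (seg-marked s (trans (sym (proj₁ (fire-moved f eq lj))) q)))
      seg-depth (s ▷ f) (there x∈) = depth-suc (seg-depth s x∈)

      fire-step : Fire es M m M′ → nth es m ≡ just e → GStep (state M) (gt e) (state M′)
      fire-step {M = M} {M′ = M′} {e = e} f eq = valid e , go
        where
        go : ∀ j → LocStep (state M j) (loc (gt e) j) (state M′ j)
        go j with loc (gt e) j in lj
        ... | nothing       rewrite fire-kept f eq lj = stay
        ... | just (s , s′) with p , q ← fire-moved f eq lj =
          subst₂ (λ a b → LocStep a (just (s , s′)) b)
                 (trans (sym (condLab-lab (pre-lab eq lj))) (cong (lab j) p))
                 (sym (trans (cong (lab j) q) (lab-out eq lj))) move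

      unmoved-silent : nth es m ≡ just e → ¬ Moves m i → inI (act (gt e)) ≡ false
      unmoved-silent {e = e} eq ¬mv with loc (gt e) i in lj
      ... | just l  = contradiction (_ , l , eq , lj) ¬mv
      ... | nothing = stays-interface (valid e) lj

      moves-IEv : nth es m ≡ just e → Moves m i → IsIEv e
      moves-IEv eq (e′ , l , eq′ , lj) with refl ← unjust eq eq′ = moves-interface (valid e′) lj

      seg-silent : Seg M ms M′ → (∀ {x} → x ∈ ms → ¬ Moves x i) → Silent (state M) (state M′)
      seg-silent (start p) _ = done λ j → cong (lab j) (p j)
      seg-silent (s ▷ f@(e , eq , _)) ¬mv =
        silent-snoc (seg-silent s (λ x∈ → ¬mv (there x∈)))
                    (unmoved-silent eq (¬mv (here refl))) (fire-step f eq)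

      -- A chosen firing sequence of the strict past of the event. Up to pointwise equality, `after`
      -- is the marking M(e), and its `state` is St(e).
      record Local (m : ℕ) (e : Ev) : Set where
        field
          event      : nth es m ≡ just e
          past       : List ℕ
          before     : Marking
          past-seg   : Seg M0 past before
          past⇔      : ∀ x → x ∈ past ⇔ Before es (pre e) x
          pre-marked : ∀ j {l} → loc (gt e) j ≡ just l → pre e j ≡ before j

        after : Marking
        after = after-fire m e before

        fires : Fire es before m after
        fires = fire-enabled event pre-marked

        seg : Seg M0 (m ∷ past) after
        seg = past-seg ▷ fires

        seg⇒past : x ∈ m ∷ past → Past es x m
        seg⇒past (here refl) = here
        seg⇒past (there x∈)  = before-past event (to (past⇔ _) x∈)

        past⇒seg : Past es x m → x ∈ m ∷ past
        past⇒seg b with past-cases event b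
        ... | inj₁ refl = here refl
        ... | inj₂ b′   = there (from (past⇔ _) b′)

        after-i : IsIEv e → after i ≡ just m
        after-i ie = proj₂ (fire-moved fires event (proj₂ (interface-moves (valid e) ie)))

        mark-after : MarkOf es m M → M ≐ after
        mark-after {M = M} (ms , o , ⇔ms) with ms′ , s′ , ⇔ms′ ← occ→seg (start (λ _ → refl)) o =
          seg-unique s′ seg
            (λ x∈ → case to (⇔ms′ _) x∈ of λ { (inj₁ ()) ; (inj₂ y) → past⇒seg (to (⇔ms _) y) })
            (λ x∈ → from (⇔ms′ _) (inj₂ (from (⇔ms _) (seg⇒past x∈))))

        after-mark : ∃[ M ] (M ≐ after × MarkOf es m M)
        after-mark with M , ms , p , o , ⇔ms ← seg→occ seg =
          M , p , ms , o , λ x → mk⇔ (λ x∈ → seg⇒past (to (⇔ms x) x∈)) (λ b → from (⇔ms x) (past⇒seg b))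

        st⇒ : StOf es m g → g ≐ state after
        st⇒ (M , mk , cl) j = trans (sym (condLab-lab (cl j))) (cong (lab j) (mark-after mk j))

        st⇐ : g ≐ state after → StOf es m g
        st⇐ p with M , q , mk ← after-mark =
          M , mk , λ j → subst₂ (CondLab es j) (sym (q j)) (sym (p j))
                                (present-condLab (present (seg-inv seg) j))

      -- The sequence from `enabled` contains the strict past, because it marks the preset; `split`
      -- cuts it down to exactly that past, after which the preset is still marked.
      local : nth es m ≡ just e → Local m e
      local {m = m} {e = e} eq with ms , M , s , en ← enabled eq
        with M₁ , ms₂ , s₁ , s₂ ← split (before? (pre e)) before-downClosed s = record
        { event      = eq
        ; past       = filter (before? (pre e)) ms
        ; before     = M₁
        ; past-seg   = s₁
        ; past⇔      = λ x → mk⇔ (proj₂ ∘ ∈-filter⁻ (before? (pre e)) {xs = ms})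
                                 (λ b → ∈-filter⁺ (before? (pre e)) (in-ms b) b)
        ; pre-marked = λ j lj → trans (en j lj) (sym (restrict-agree (before? (pre e)) s s₁
                                  λ q → j , _ , trans (en j lj) q , here))
        }
        where
        in-ms : Before es (pre e) x → x ∈ ms
        in-ms (j , y , q , b) with l , lj ← pre-moves eq q =
          seg-past s (proj₁ (seg-marked s (trans (sym (en j lj)) q))) b

      st-unique : nth es m ≡ just e → StOf es m g → StOf es m g′ → g ≐ g′
      st-unique eq p q j = trans (Local.st⇒ (local eq) p j) (sym (Local.st⇒ (local eq) q j))

      st-resp : nth es m ≡ just e → g ≐ g′ → StOf es m g → StOf es m g′
      st-resp eq p q = Local.st⇐ (local eq) λ j → trans (sym (p j)) (Local.st⇒ (local eq) q j)

  -- Adding one event to a net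

  module Extension (es : Events) (e₀ : Ev) where
    es⁺ : Events
    es⁺ = es ++ [ e₀ ]

    private
      module N  = Net es
      module N⁺ = Net es⁺

    fire-lift : Fire es M m M′ → Fire es⁺ M m M′
    fire-lift (e , eq , f) = e , nth-++ es eq , f

    seg-lift : N.Seg M ms M′ → N⁺.Seg M ms M′
    seg-lift (N.start p) = N⁺.start p
    seg-lift (s N.▷ f)   = seg-lift s N⁺.▷ fire-lift f

    occ-lift : Occ es M ms M′ → Occ es⁺ M ms M′
    occ-lift []      = []
    occ-lift (f ∷ o) = fire-lift f ∷ occ-lift o

    condLab-lift : ∀ {j c s} → CondLab es j c s → CondLab es⁺ j c s
    condLab-lift init        = init
    condLab-lift (out eq lj) = out (nth-++ es eq) lj

    past-lift : Past es x m → Past es⁺ x m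
    past-lift here          = here
    past-lift (back eq q b) = back (nth-++ es eq) q (past-lift b)

    module _ (wf : N.WF) where
      open N.WF wf

      past-unlift : m < length es → Past es⁺ x m → Past es x m
      past-unlift m< here = here
      past-unlift m< (back eq⁺ q b) with eq ← nth-snoc-< es eq⁺ m< =
        back eq q (past-unlift (<-trans (pre-< eq q) m<) b)

      st-lift : m < length es → StOf es m g → StOf es⁺ m g
      st-lift m< (M , (ms , o , ⇔ms) , cl) =
        M , (ms , occ-lift o , λ x → mk⇔ (past-lift ∘ to (⇔ms x)) (from (⇔ms x) ∘ past-unlift m<)) ,
        condLab-lift ∘ cl

      -- Instead of cutting back a firing sequence, the state computed in the old net is lifted and
      -- identified by uniqueness in the extended one.
      st-unlift : N⁺.WF → nth es m ≡ just e → StOf es⁺ m g → StOf es m g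
      st-unlift wf⁺ eq st⁺ =
        L.st⇐ (N⁺.WellFormed.st-unique wf⁺ (nth-++ es eq) st⁺
                (st-lift (nth-< es eq) (L.st⇐ λ _ → refl)))
        where module L = N.WellFormed.Local (N.WellFormed.local wf eq)

      wf-extend : PossExt es e₀ → N⁺.WF
      wf-extend ((M , (_ , o) , ext) , new) = record
        { pre-< = pre-<⁺ ; pre-⋆ = pre-⋆⁺ ; pre-lab = pre-lab⁺ ; no-repeat = no-repeat⁺ ; enabled = enabled⁺ }
        where
        seg-M : ∃[ ms ] N.Seg M0 ms M
        seg-M = let ms , s , _ = N.occ→seg (N.start λ _ → refl) o in ms , s

        ext-moved : ∀ {j l p c s s′} → ExtLoc es j l p c → l ≡ just (s , s′) → p ≡ c × CondLab es j p s
        ext-moved (esome cl) refl = refl , cl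

        ext-⋆ : ∀ {j l p c} → ExtLoc es j l p c → l ≡ nothing → p ≡ nothing
        ext-⋆ enone refl = refl

        pre-<⁺ : ∀ {m e x j} → nth es⁺ m ≡ just e → pre e j ≡ just x → x < m
        pre-<⁺ {j = j} eq⁺ q with nth-snoc⁻ es eq⁺
        ... | inj₁ eq = pre-< eq q
        ... | inj₂ (refl , refl) with loc (gt e₀) j in lj
        ... | nothing = contradiction q (nothing≢just (ext-⋆ (ext j) lj))
        -- The input condition is marked by `M`, hence produced by an event of `es`, whose index
        -- precedes that of the new event.
        ... | just _ = let _ , _ , eq , _ = proj₂ (N.WellFormed.seg-marked wf (proj₂ seg-M)
                                             (trans (sym (proj₁ (ext-moved (ext j) lj))) q))
                       in nth-< es eq

        pre-⋆⁺ : ∀ {m e j} → nth es⁺ m ≡ just e → loc (gt e) j ≡ nothing → pre e j ≡ nothing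
        pre-⋆⁺ {j = j} eq⁺ lj with nth-snoc⁻ es eq⁺
        ... | inj₁ eq         = pre-⋆ eq lj
        ... | inj₂ (_ , refl) = ext-⋆ (ext j) lj

        pre-lab⁺ : ∀ {m e j s s′} → nth es⁺ m ≡ just e → loc (gt e) j ≡ just (s , s′)
                 → CondLab es⁺ j (pre e j) s
        pre-lab⁺ {j = j} eq⁺ lj with nth-snoc⁻ es eq⁺
        ... | inj₁ eq         = condLab-lift (pre-lab eq lj)
        ... | inj₂ (_ , refl) = condLab-lift (proj₂ (ext-moved (ext j) lj))

        sameEv-sym : SameEv e e′ → SameEv e′ e
        sameEv-sym (p , q , r) = sym p , (λ j → sym (q j)) , λ j → sym (r j)

        no-repeat⁺ : ∀ {m e x e′} → nth es⁺ m ≡ just e → nth es⁺ x ≡ just e′ → SameEv e e′ → m ≡ x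
        no-repeat⁺ {e = e} eq⁺ eq′⁺ same with nth-snoc⁻ es eq⁺ | nth-snoc⁻ es eq′⁺
        ... | inj₁ eq            | inj₁ eq′           = no-repeat eq eq′ same
        ... | inj₁ eq            | inj₂ (_ , refl)    = contradiction (_ , _ , eq , sameEv-sym {e} {e₀} same) new
        ... | inj₂ (_ , refl)    | inj₁ eq′           = contradiction (_ , _ , eq′ , same) new
        ... | inj₂ (refl , _)    | inj₂ (refl , _)    = refl

        enabled⁺ : ∀ {m e} → nth es⁺ m ≡ just e
                 → ∃[ ms ] ∃[ M ] (N⁺.Seg M0 ms M × (∀ j {l} → loc (gt e) j ≡ just l → pre e j ≡ M j))
        enabled⁺ eq⁺ with nth-snoc⁻ es eq⁺
        ... | inj₁ eq         = let ms , M , s , en = enabled eq in ms , M , seg-lift s , en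
        ... | inj₂ (_ , refl) = proj₁ seg-M , M , seg-lift (proj₂ seg-M) , λ j lj → proj₁ (ext-moved (ext j) lj)

  bp-wf : IsBP es → Net.WF es
  bp-wf bp0 = record { pre-< = λ () ; pre-⋆ = λ () ; pre-lab = λ () ; no-repeat = λ () ; enabled = λ () }
  bp-wf (bpext {es} {e} bp ext) = Extension.wf-extend es e (bp-wf bp) ext

  -- Algorithm 1

  record Good (c : Config) (es : Events) : Set where
    field
      bp        : IsBP es
      cut       : nth c m ≡ just (e , just x)
                → IsIEv e × x < m × (∃[ e′ ] nth es x ≡ just e′ × IsIEv e′) × SameSt es m x
      uncut     : nth c m ≡ just (e , nothing) → IsIEv e
                → x < m → nth es x ≡ just e′ → IsIEv e′ → ¬ SameSt es m x
      unblocked : ∀ {o} → nth c m ≡ just (e , o) → Before es (pre e) x → ¬ InCo c x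

  -- Pasts and states of old events do not change, so the tests made when they were added remain
  -- valid. The event list is a separate argument of `Good` because `evs` of the new configuration
  -- equals `evs c ++ [ e ]` only propositionally.
  good-extend : ∀ {c e o} → Good c (evs c) → PossExt (evs c) e → ¬ Blocked c e
              → (∀ {x} → o ≡ just x → IsIEv e × Companion c e x)
              → (o ≡ nothing → ¬ (IsIEv e × ∃[ x ] Companion c e x))
              → Good (c ++ [ (e , o) ]) (evs c ++ [ e ])
  good-extend {c} {e} {o} G ext free isCut isUncut = record
    { bp = bpext bp ext ; cut = cut⁺ ; uncut = uncut⁺ ; unblocked = unblocked⁺ }
    where
    open Good G
    open Extension (evs c) e
    c⁺ : Config
    c⁺ = c ++ [ (e , o) ]
    wf : Net.WF (evs c)
    wf = bp-wf bp
    wf⁺ : Net.WF es⁺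
    wf⁺ = wf-extend wf ext
    len : length (evs c) ≡ length c
    len = length-map proj₁ c

    ev : ∀ {m z} → nth c m ≡ just z → nth (evs c) m ≡ just (proj₁ z)
    ev = nth-map proj₁ c

    <evs : m < length c → m < length (evs c)
    <evs = subst (_ <_) (sym len)

    same-lift : m < length c → x < length c → SameSt (evs c) m x → SameSt es⁺ m x
    same-lift m< x< (g , p , q) = g , st-lift wf (<evs m<) p , st-lift wf (<evs x<) q

    cut⁺ : ∀ {m e x} → nth c⁺ m ≡ just (e , just x)
         → IsIEv e × x < m × (∃[ e′ ] nth es⁺ x ≡ just e′ × IsIEv e′) × SameSt es⁺ m x
    cut⁺ eq⁺ with nth-snoc⁻ c eq⁺
    ... | inj₁ eq with ie , x<m , (e′ , eq′ , ie′) , same ← cut eq =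
      ie , x<m , (e′ , nth-++ (evs c) eq′ , ie′) ,
      same-lift (nth-< c eq) (<-trans x<m (nth-< c eq)) same
    cut⁺ eq⁺ | inj₂ (refl , refl) with ie , x< , (e′ , eq′ , ie′) , same ← isCut refl =
      ie , x< , (e′ , nth-++ (evs c) eq′ , ie′) , same

    uncut⁺ : ∀ {m e x e′} → nth c⁺ m ≡ just (e , nothing) → IsIEv e
           → x < m → nth es⁺ x ≡ just e′ → IsIEv e′ → ¬ SameSt es⁺ m x
    uncut⁺ eq⁺ ie x<m eq′⁺ ie′ same with nth-snoc⁻ c eq⁺
    ... | inj₁ eq with eq′ ← nth-snoc-< (evs c) eq′⁺ (<evs (<-trans x<m (nth-< c eq)))
                  with g , p , q ← same =
      uncut eq ie x<m eq′ ie′ (g , st-unlift wf wf⁺ (ev eq) p , st-unlift wf wf⁺ eq′ q)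
    uncut⁺ eq⁺ ie x<m eq′⁺ ie′ same | inj₂ (refl , refl) =
      isUncut refl (ie , _ , x<m , (_ , nth-snoc-< (evs c) eq′⁺ (<evs x<m) , ie′) , same)

    before-unlift : ∀ {p x} → (∀ {j y} → p j ≡ just y → y < length (evs c))
                  → Before es⁺ p x → Before (evs c) p x × x < length c
    before-unlift p< (j , y , q , b) with b′ ← past-unlift wf (p< q) b =
      (j , y , q , b′) , subst (_ <_) len (≤-<-trans (Net.WellFormed.past-≤ (evs c) wf b′) (p< q))

    unblocked⁺ : ∀ {m e x o} → nth c⁺ m ≡ just (e , o) → Before es⁺ (pre e) x → ¬ InCo c⁺ x
    unblocked⁺ eq⁺ b⁺ (ex , y , eqx) with nth-snoc⁻ c eq⁺
    ... | inj₁ eq =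
      let b , x< = before-unlift (λ q → <-trans (Net.WF.pre-< wf (ev eq) q) (<evs (nth-< c eq))) b⁺
      in unblocked eq b (ex , y , nth-snoc-< c eqx x<)
    ... | inj₂ (refl , refl) =
      let b , x< = before-unlift (λ q → Net.WF.pre-< wf⁺ (nth-last (evs c)) q) b⁺
      in free (_ , b , ex , y , nth-snoc-< c eqx x<)

  good-step : ∀ {c c′} → Good c (evs c) → Step c c′ → Good c′ (evs c′)
  good-step {c} G (scut {e} {m} ext free ie comp) =
    subst (Good _) (sym (map-++ proj₁ c [ (e , just m) ]))
          (good-extend G ext free (λ { refl → ie , comp }) λ ())
  good-step {c} G (snocut {e} ext free ¬cut) =
    subst (Good _) (sym (map-++ proj₁ c [ (e , nothing) ]))
          (good-extend G ext free (λ ()) λ _ → ¬cut)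

  good-reachable : ∀ {c c′} → Good c (evs c) → Star Step c c′ → Good c′ (evs c′)
  good-reachable G ε       = G
  good-reachable G (s ◅ r) = good-reachable (good-step G s) r

  good-initial : Good [] []
  good-initial = record { bp = bp0 ; cut = λ () ; uncut = λ () ; unblocked = λ () }

  -- Counting the events of bounded depth

  GS-coding : Coding GS _≐_
  GS-coding = Π-coding λ j → Fin-coding (nS (A j))

  -- A moment of a run is recorded by its global state and by the coded state of the event that
  -- produced the current i-condition, with `nothing` for the initial condition.
  trail-coding : Coding (GS × Maybe (Fin (size GS-coding)))
                        (λ p q → proj₁ p ≐ proj₁ q × proj₂ p ≡ proj₂ q)
  trail-coding = ×-coding GS-coding (Maybe-coding (Fin-coding (size GS-coding)))

  -- The data identifying an event: action, local transitions and, per component, the code of the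
  -- producer of its input among `s` codes.
  Shape : ℕ → Set
  Shape s = Fin k × ((j : Fin n) → Maybe (Fin (nS (A j)) × Fin (nS (A j)))) × (Fin n → Maybe (Fin s))

  shape-coding : ∀ s → Coding (Shape s) λ p q →
    proj₁ p ≡ proj₁ q × proj₁ (proj₂ p) ≐ proj₁ (proj₂ q) × proj₂ (proj₂ p) ≐ proj₂ (proj₂ q)
  shape-coding s = ×-coding (Fin-coding k)
    (×-coding (Π-coding λ j → Maybe-coding (×-coding-≡ (Fin-coding (nS (A j))) (Fin-coding (nS (A j)))))
              (Π-coding λ _ → Maybe-coding (Fin-coding s)))

  -- One code is reserved for indices that name no event; at depth 0, which no event has, it is the
  -- only one.
  event-codes : ℕ → ℕ
  event-codes zero    = 1
  event-codes (suc d) = suc (size (shape-coding (event-codes d)))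

  module _ (es : Events) where
    open Net es

    shape : ∀ d → (ℕ → Fin (event-codes d)) → Ev → Shape (event-codes d)
    shape d f e = act (gt e) , loc (gt e) , λ j → Maybe.map f (pre e j)

    event-code : ∀ d → ℕ → Fin (event-codes d)
    event-code zero    m = zero
    event-code (suc d) m = maybe′ (suc ∘ code (shape-coding _) ∘ shape d (event-code d)) zero (nth es m)

    event-code-just : ∀ d → nth es m ≡ just e
                    → event-code (suc d) m ≡ suc (code (shape-coding _) (shape d (event-code d) e))
    event-code-just d eq rewrite eq = refl

    -- By induction on the depth, equal codes give equal transitions and equal producers of the
    -- inputs, and a branching process has no two such events.
    event-code-injective : WF → ∀ {d} → Depth d m → Depth d x → event-code d m ≡ event-code d x → m ≡ x
    event-code-injective wf {suc d} (deeper {e = e} eq h) (deeper {e = e′} eq′ h′) same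
      with p , q , r ← code-injective (shape-coding _) {shape d (event-code d) e} {shape d (event-code d) e′}
                         (sucᶠ-injective (trans (sym (event-code-just d eq)) (trans same (event-code-just d eq′)))) =
      WF.no-repeat wf eq eq′ (p , q , pres)
      where
      pres : ∀ j → pre e j ≡ pre e′ j
      pres j with pre e j in a | pre e′ j in b | r j
      ... | nothing | nothing | _ = refl
      ... | just y  | just z  | s = cong just (event-code-injective wf (h a) (h′ b) (just-injective s))

    length-bound : WF → ∀ d → (∀ {m e} → nth es m ≡ just e → Depth d m) → length es ≤ event-codes d
    length-bound wf d deep = ≮⇒≥ λ big →
      let p , q , p<q , q≤ , same = repetition (Fin-coding (event-codes d)) (event-code d)
          q<  = ≤-<-trans q≤ big
          _ , eqp = nth-just es (<-trans p<q q<)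
          _ , eqq = nth-just es q<
      in <⇒≢ p<q (event-code-injective wf (deep eqp) (deep eqq) same)

  -- Short pasts and the size of reachable configurations

  module Configuration (c : Config) (G : Good c (evs c)) where
    open Good G public
    open Net (evs c) public
    wf : WF
    wf = bp-wf bp
    open WellFormed wf public

    Free : ℕ → Set
    Free m = ∃[ e ] nth c m ≡ just (e , nothing)

    ev : ∀ {z} → nth c m ≡ just z → nth (evs c) m ≡ just (proj₁ z)
    ev = nth-map proj₁ c

    entry : nth (evs c) m ≡ just e → ∃[ o ] nth c m ≡ just (e , o)
    entry eq with (_ , o) , eq′ , refl ← nth-map⁻ proj₁ c eq = o , eq′

    free : nth (evs c) m ≡ just e → ¬ InCo c m → Free m
    free {e = e} eq ¬co with entry eq
    ... | nothing , eq′ = e , eq′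
    ... | just x  , eq′ = contradiction (_ , x , eq′) ¬co

    seg-event : Seg M ms M′ → x ∈ ms → ∃[ e ] nth (evs c) x ≡ just e
    seg-event (s ▷ (e , eq , _)) (here refl) = e , eq
    seg-event (s ▷ _)            (there x∈)  = seg-event s x∈

    past-free : (l : Local m e) → x ∈ Local.past l → Free x
    past-free l x∈ = free (proj₂ (seg-event (Local.past-seg l) x∈))
      (unblocked (proj₂ (entry (Local.event l))) (to (Local.past⇔ l _) x∈))

    -- Of two distinct i-events with the same state, the later one would have been made a cut-off.
    free-unique : ∀ {g} → Free m → Free x → Moves m i → Moves x i → StOf (evs c) m g → StOf (evs c) x g → m ≡ x
    free-unique {m = m} {x = x} (_ , eq) (_ , eq′) mv mv′ st st′ with <-cmp m x
    ... | tri≈ _ m≡x _ = m≡x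
    ... | tri< m<x _ _ = contradiction (_ , st′ , st)
      (uncut eq′ (moves-IEv (ev eq′) mv′) m<x (ev eq) (moves-IEv (ev eq) mv))
    ... | tri> _ _ x<m = contradiction (_ , st , st′)
      (uncut eq (moves-IEv (ev eq) mv) x<m (ev eq′) (moves-IEv (ev eq′) mv′))

    -- The default `gs0` at indices without an event lets `trail` be defined at all times without
    -- evidence that its i-condition exists.
    total-state : ∀ m → ∃[ g ] (∀ {e} → nth (evs c) m ≡ just e → StOf (evs c) m g)
    total-state m with nth (evs c) m in eq
    ... | nothing = gs0 , λ ()
    ... | just e  = state (Local.after (local eq)) , λ _ → Local.st⇐ (local eq) λ _ → refl

    short-past : NonDivergent → Seg M0 ms M → (∀ {x} → x ∈ ms → Free x) → length ms ≤ size trail-coding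
    short-past {ms = ms} nd s allFree = ≮⇒≥ λ long → nd (diverge (<⇒≤ long))
      where
      run = forward s
      mk = proj₁ run
      f = proj₁ (proj₂ run)
      mk0 : M0 ≐ mk 0
      mk0 = proj₁ (proj₂ (proj₂ run))
      fires : ∀ x → x < length ms → Fire (evs c) (mk x) (f x) (mk (suc x)) × f x ∈ ms
      fires = proj₂ (proj₂ (proj₂ run))

      trail : ℕ → GS × Maybe (Fin (size GS-coding))
      trail x = state (mk x) , Maybe.map (λ m → code GS-coding (proj₁ (total-state m))) (mk x i)

      diverge : size trail-coding ≤ length ms → Divergent
      diverge long with p , q , p<q , q≤ , same , samei ← repetition trail-coding trail =
        lasso (state ∘ mk) p q p<q (λ j → cong (lab j) (sym (mk0 j))) (λ j → sym (same j)) steps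
        where
        fires< : ∀ x → x < q → Fire (evs c) (mk x) (f x) (mk (suc x)) × f x ∈ ms
        fires< x x<q = fires x (<-≤-trans x<q (≤-trans q≤ long))

        reach : ∀ x → x ≤ q → ∃[ ms′ ] (Seg M0 ms′ (mk x) × (∀ {y} → y ∈ ms′ → y ∈ ms))
        reach x x≤q =
          let ms′ , s′ , ⊆ , _ = collect {P = _∈ ms} mk f (λ y y<x → fires< y (<-≤-trans y<x x≤q)) (≤⇒≤′ z≤n)
          in _ , seg-++ (start mk0) s′ , λ y∈ → ⊆ (subst (_ ∈_) (++-identityʳ ms′) y∈)

        current-event : ∀ {x y} → x ≤ q → mk x i ≡ just y → Free y × Moves y i
        current-event {x} x≤q eq with _ , s′ , ⊆ ← reach x x≤q =
          let y∈ , mv = seg-marked s′ eq in allFree (⊆ y∈) , mv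

        -- Equal codes mean equal states of the two producing i-events; both are uncut, so they are
        -- the same event.
        same-condition : proj₂ (trail p) ≡ proj₂ (trail q) → mk p i ≡ mk q i
        same-condition eq with mk p i in a | mk q i in b | eq
        ... | nothing | nothing | _ = refl
        ... | just y  | just z  | s =
          let fy@(_ , eqy) , my = current-event (<⇒≤ p<q) a
              fz@(_ , eqz) , mz = current-event ≤-refl b
              eq = code-injective GS-coding (just-injective s)
          in cong just (free-unique fy fz my mz (proj₂ (total-state y) (ev eqy))
               (st-resp (ev eqz) (λ j → sym (eq j)) (proj₂ (total-state z) (ev eqz))))

        steps : ∀ x → x < q → ∃[ t ] GStep (state (mk x)) t (state (mk (suc x))) × (p ≤ x → inI (act t) ≡ false)
        steps x x<q with fire@(e , eq , _) , _ ← fires< x x<q =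
          gt e , fire-step fire eq , λ p≤x →
            -- The same i-condition is marked at `p` and at `q`, so no event fired in between moves
            -- the interface.
            let _ , s₁ , _ = reach p (<⇒≤ p<q)
                _ , s₂ , _ , has = collect {P = _∈ ms} mk f fires< (≤⇒≤′ (<⇒≤ p<q))
            in unmoved-silent eq (unmoved s₁ s₂ (same-condition samei) (has x p≤x x<q))

    size-bound : NonDivergent → length c ≤ event-codes (suc (size trail-coding))
    size-bound nd = subst (_≤ _) (length-map proj₁ c) (length-bound (evs c) wf _ deep)
      where
      deep : ∀ {m e} → nth (evs c) m ≡ just e → Depth (suc (size trail-coding)) m
      -- The strict past consists of uncut events and is therefore short; the event itself, possibly
      -- a cut-off, adds one.
      deep eq = depth-≤ (s≤s (short-past nd (Local.past-seg l) (past-free l))) (seg-depth (Local.seg l) (here refl))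
        where l = local eq

  -- Termination of the unfolding procedure

  reachable-good : ∀ {c} → Reachable c → Good c (evs c)
  reachable-good = good-reachable good-initial

  -- Each step adds one event and reachable configurations are bounded in size, so the room left
  -- below the bound serves as fuel.
  terminates : NonDivergent → Terminates
  terminates nd = go (suc bound) [] ε (n<1+n bound)
    where
    bound = event-codes (suc (size trail-coding))

    step-length : ∀ {c c′} → Step c c′ → length c′ ≡ suc (length c)
    step-length {c} (scut _ _ _ _)  = trans (length-++ c) (+-comm (length c) 1)
    step-length {c} (snocut _ _ _)  = trans (length-++ c) (+-comm (length c) 1)

    go : ∀ fuel c → Reachable c → bound < length c + fuel → Acc (λ c′ c → Step c c′) c
    go zero       c r b< = contradiction
      (Configuration.size-bound c (reachable-good r) nd) (<⇒≱ (subst (bound <_) (+-identityʳ _) b<))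
    go (suc fuel) c r b< = acc λ {c′} s →
      go fuel c′ (r ◅◅ (s ◅ ε))
         (subst (bound <_) (trans (+-suc (length c) fuel) (cong (_+ fuel) (sym (step-length s)))) b<)

  -- The folding

  module Folding (c : Config) (G : Good c (evs c)) where
    open Configuration c G

    data StateAt : Maybe ℕ → GS → Set where
      at-start : g ≐ gs0 → StateAt nothing g
      at-event : StOf (evs c) m g → StateAt (just m) g

    -- Soundness: realizing runs of the folding

    mark-i : nth (evs c) m ≡ just e → IsIEv e → MarkOf (evs c) m M → M i ≡ just m
    mark-i eq ie mk = trans (Local.mark-after (local eq) mk i) (Local.after-i (local eq) ie)

    same-transfer : nth (evs c) m ≡ just e → nth (evs c) x ≡ just e′ → SameSt (evs c) m x
                  → StOf (evs c) m g → StOf (evs c) x g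
    same-transfer eq eq′ (g , p , q) st = st-resp eq′ (st-unique eq p st) q

    same-sym : SameSt (evs c) m x → SameSt (evs c) x m
    same-sym (g , p , q) = g , q , p

    -- Cut-off and companion are both i-events, so M(e) and M(e') contain their own output
    -- i-conditions. In particular no generator involves the initial i-condition.
    gen-cases : ∀ {b b′} → Gen c b b′ → ∃[ m ] ∃[ x ] (b ≡ just m × b′ ≡ just x
      × (∀ {g} → StOf (evs c) m g → StOf (evs c) x g) × (∀ {g} → StOf (evs c) x g → StOf (evs c) m g))
    gen-cases (m , e , x , eq , M , M′ , mk , mk′ , refl , refl)
      with ie , _ , (e′ , eq′ , ie′) , same ← cut eq =
      m , x , mark-i (ev eq) ie mk , mark-i eq′ ie′ mk′ ,
      same-transfer (ev eq) eq′ same , same-transfer eq′ (ev eq) (same-sym same)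

    equiv-state : ∀ {b b′} → Equiv c b b′ → StateAt b g → StateAt b′ g
    equiv-state ε         st = st
    equiv-state (fwd h ◅ r) st with m , x , refl , refl , f , _ ← gen-cases h
                               with at-event s ← st = equiv-state r (at-event (f s))
    equiv-state (bwd h ◅ r) st with m , x , refl , refl , _ , f ← gen-cases h
                               with at-event s ← st = equiv-state r (at-event (f s))

    interface-step : (eq : nth (evs c) m ≡ just e) → IsIEv e → StateAt (pre e i) g
                   → ∃[ g′ ] (Silent g g′ × GStep g′ (gt e) (state (Local.after (local eq))))
    interface-step {m = m} {e = e} {g = g} eq ie st = state before , go (pre e i) refl st , fire-step fires eq
      where
      open Local (local eq)
      pre≡ : pre e i ≡ before i
      pre≡ = pre-marked i (proj₂ (interface-moves (valid e) ie))

      go : ∀ b → pre e i ≡ b → StateAt b g → Silent g (state before)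
      -- The initial i-condition is still marked just before the event, so nothing in its strict
      -- past has moved the interface.
      go nothing q (at-start p) =
        silent-respˡ (λ j → sym (p j))
          (seg-silent past-seg (unmoved (start λ _ → refl) past-seg (trans (sym q) pre≡)))
      -- With the past of `x` fired first, the i-condition produced by `x` is marked from then until
      -- the event, so the events in between are silent.
      go (just x) q (at-event sx)
        with M₁ , ms₂ , s₁ , s₂ ← split (λ y → past? y x) past-downClosed past-seg =
        silent-respˡ (λ j → trans (cong (lab j) (same j)) (sym (Lx.st⇒ sx j)))
          (seg-silent s₂ (unmoved s₁ s₂ (restrict-agree (λ y → past? y x) past-seg s₁ last)))
        where
        x∈ : x ∈ past
        x∈ = from (past⇔ x) (i , x , q , here)
        module Lx = Local (local (proj₂ (seg-event past-seg x∈)))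
        last : ∀ {y} → before i ≡ just y → Past (evs c) y x
        last r = subst (λ z → Past (evs c) z x) (just-injective (trans (sym q) (trans pre≡ r))) here
        same : M₁ ≐ Lx.after
        same = seg-unique s₁ Lx.seg
          (λ y∈ → Lx.past⇒seg (proj₂ (∈-filter⁻ (λ y → past? y x) {xs = past} y∈)))
          (λ y∈ → ∈-filter⁺ (λ y → past? y x)
                    (from (past⇔ _) (i , x , q , Lx.seg⇒past y∈)) (Lx.seg⇒past y∈))

    sound-fin : ∀ {b w} → FoldRun c b w → StateAt b g → ∃[ ts ] (FinRun g ts × projL (map act ts) ≡ w)
    sound-fin [] st = [] , [] , refl
    sound-fin (step {e = e} eq ie b≡ r) st
      with g₁ , sil , s ← interface-step eq ie (equiv-state b≡ st)
      with ts , r′ , w≡ ← sound-fin r (at-event (Local.st⇐ (local eq) λ _ → refl))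
      with ts′ , r″ , eq′ ← silent-run sil (s ∷ r′) =
      ts′ , r″ , trans eq′ (trans (cong (if_then act (gt e) ∷ projL (map act ts) else projL (map act ts)) ie)
                                  (cong (act (gt e) ∷_) w≡))

    sound-inf : ∀ {u} → FoldInf c u → ProjInf u
    sound-inf (ms , fs , eqs , ies , b₀ , bs , u≡) =
      Concatenation.projInf at (proj₁ ∘ segment) (gt ∘ fs) (proj₁ ∘ proj₂ ∘ segment)
        (proj₂ ∘ proj₂ ∘ segment) ies (λ _ → refl) u≡
      where
      at : ℕ → GS
      at zero    = gs0
      at (suc l) = state (Local.after (local (eqs l)))

      stateAt : ∀ l → StateAt (pre (fs l) i) (at l)
      stateAt zero    = equiv-state b₀ (at-start λ _ → refl)
      stateAt (suc l) = equiv-state (bs l) (at-event (Local.st⇐ (local (eqs l)) λ _ → refl))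

      segment : ∀ l → ∃[ g ] (Silent (at l) g × GStep g (gt (fs l)) (at (suc l)))
      segment l = interface-step (eqs l) (ies l) (stateAt l)

    -- Completeness: following runs of the composition in the folding

    uncut-companion : nth (evs c) m ≡ just e → IsIEv e
      → ∃[ x ] ∃[ e′ ] (nth c x ≡ just (e′ , nothing) × IsIEv e′ × Equiv c (just m) (just x)
        × (∀ {g} → StOf (evs c) m g → StOf (evs c) x g))
    uncut-companion {m = m} eq ie = go (suc m) ≤-refl eq ie
      where
      go : ∀ fuel {m e} → m < fuel → nth (evs c) m ≡ just e → IsIEv e
        → ∃[ x ] ∃[ e′ ] (nth c x ≡ just (e′ , nothing) × IsIEv e′ × Equiv c (just m) (just x)
          × (∀ {g} → StOf (evs c) m g → StOf (evs c) x g))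
      go (suc fuel) {m} {e} m< eq ie with entry eq
      ... | nothing , eqc = m , e , eqc , ie , ε , λ st → st
      -- The companion may be a cut-off in turn, but it has a smaller index, so the chain of
      -- companions ends.
      ... | just x , eqc
        with _ , x<m , (e′ , eq′ , ie′) , same ← cut eqc
        with y , e″ , eqy , iey , x~y , f ← go fuel (<-≤-trans x<m (s≤s⁻¹ m<)) eq′ ie′
        with M , _ , mk ← Local.after-mark (local eq)
        with M′ , _ , mk′ ← Local.after-mark (local eq′) =
        y , e″ , eqy , iey ,
        fwd (m , e , x , eqc , M , M′ , mk , mk′ , mark-i eq ie mk , mark-i eq′ ie′ mk′) ◅ x~y ,
        λ st → f (same-transfer eq eq′ same st)

    -- A point from which the net can be continued: as only uncut events have fired, no possible
    -- extension enabled here is blocked.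
    record Base : Set where
      field
        marking : Marking
        fired   : List ℕ
        seg     : Seg M0 fired marking
        allFree : ∀ {x} → x ∈ fired → Free x
    open Base

    sameEv? : ∀ e e′ → Dec (SameEv e e′)
    sameEv? e e′ = (act (gt e) ≟ᶠ act (gt e′))
      ×-dec all? (λ j → Maybeₚ.≡-dec (Productₚ.≡-dec _≟ᶠ_ _≟ᶠ_) (loc (gt e) j) (loc (gt e′) j))
      ×-dec all? (λ j → Maybeₚ.≡-dec _≟_ (pre e j) (pre e′ j))

    base₀ : Base
    base₀ = record { marking = M0 ; fired = [] ; seg = start (λ _ → refl) ; allFree = λ () }

    extension : Marking → ValidGT t → Ev
    extension {t = t} M v = mkEv t v λ j → maybe′ (λ _ → M j) nothing (loc t j)

    module Completeness (final : Final c) where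

      -- If no event carried this transition with the marked preset, it would be an unblocked
      -- possible extension, contrary to finality.
      advance : (B : Base) → GStep (state (marking B)) t g
              → ∃[ m ] ∃[ e ] ∃[ M ] (nth (evs c) m ≡ just e × act (gt e) ≡ act t
                × Fire (evs c) (marking B) m M × state M ≐ g)
      advance {t = t} {g = g} B (v , ls) with nth-any? (sameEv? (extension (marking B) v)) (evs c)
      ... | yes (m , e , eq , act≡ , loc≡ , pre≡) =
        m , e , after-fire m e N , eq , sym act≡ , f , λ j →
          locStep-unique (proj₂ (fire-step f eq) j) (ls j) (sym (loc≡ j))
        where
        N : Marking
        N = marking B
        f : Fire (evs c) N m (after-fire m e N)
        f = fire-enabled eq λ j lj →
          trans (sym (pre≡ j)) (cong (maybe′ (λ _ → N j) nothing) (trans (loc≡ j) lj))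
      ... | no absent = contradiction
        (extension N v ,
         ((N° , (_ , o) , λ j → subst (ExtLoc (evs c) j _ _) (sym (N°≐ j)) (ext j _ (source j))) , absent) ,
         unblocked′)
        final
        where
        N : Marking
        N = marking B
        occ = seg→occ (seg B)
        N° : Marking
        N° = proj₁ occ
        N°≐ : N° ≐ N
        N°≐ = proj₁ (proj₂ (proj₂ occ))
        o = proj₁ (proj₂ (proj₂ (proj₂ occ)))

        source : ∀ j {s s′} → loc t j ≡ just (s , s′) → CondLab (evs c) j (N j) s
        source j lj = subst (CondLab (evs c) j (N j)) (locStep-moved (ls j) lj)
                            (present-condLab (Inv.present (seg-inv (seg B)) j))

        ext : ∀ j l → (∀ {s s′} → l ≡ just (s , s′) → CondLab (evs c) j (N j) s)
            → ExtLoc (evs c) j l (maybe′ (λ _ → N j) nothing l) (N j)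
        ext j nothing  _  = enone
        ext j (just _) cl = esome (cl refl)

        marked : ∀ j {y} (l : Maybe (Fin (nS (A j)) × Fin (nS (A j)))) → maybe′ (λ _ → N j) nothing l ≡ just y → N j ≡ just y
        marked j (just _) q = q

        unblocked′ : ¬ Blocked c (extension N v)
        unblocked′ (x , (j , y , q , b) , (_ , _ , eqx)) =
          let y∈ , _   = seg-marked (seg B) (marked j (loc t j) q)
              _  , eqf = allFree B (seg-past (seg B) y∈ b)
          in contradiction (unjust eqf eqx) λ ()

      -- Cut-offs are i-events, so the event performing a silent action is uncut and the result is
      -- again a `Base`.
      advance-step : (B : Base) → inI (act t) ≡ false → GStep (state (marking B)) t g
                   → ∃[ B′ ] (state (marking B′) ≐ g × marking B′ i ≡ marking B i)
      advance-step B a s with m , e , M′ , eq , act≡ , f , q ← advance B s =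
        record { marking = M′ ; fired = m ∷ fired B ; seg = seg B ▷ f
               ; allFree = λ { (here refl) → free eq uncut′ ; (there x∈) → allFree B x∈ } } ,
        q , kept
        where
        hidden : ¬ IsIEv e
        hidden ie = contradiction (trans (sym ie) (trans (cong inI act≡) a)) λ ()
        uncut′ : ¬ InCo c m
        uncut′ (_ , _ , eqc) = hidden (subst IsIEv (unjust (ev eqc) eq) (proj₁ (cut eqc)))
        kept : M′ i ≡ marking B i
        kept with fire-cases i f
        ... | inj₁ (cs , _) = contradiction (moves-IEv eq (consumes⇒moves cs)) hidden
        ... | inj₂ (_ , r)  = r

      advance-silent : (B : Base) → g ≐ state (marking B) → Silent g g′
                     → ∃[ B′ ] (state (marking B′) ≐ g′ × marking B′ i ≡ marking B i)
      advance-silent B p (done q) = B , (λ j → trans (sym (p j)) (q j)) , refl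
      advance-silent B p (walk a s r)
        with B₁ , q , i₁ ← advance-step B a (GStep-resp p (λ _ → refl) s)
        with B₂ , st , i₂ ← advance-silent B₁ (λ j → sym (q j)) r = B₂ , st , trans i₂ i₁

      -- One transition of the folding with a base for the rest of the run. The base need not have
      -- state `g`: the postponed events survive as the silent run from it to `g`.
      record InterfaceMove (b : Maybe ℕ) (a : Fin k) (g : GS) : Set where
        field
          index  : ℕ
          event  : Ev
          lookup : nth (evs c) index ≡ just event
          ie     : IsIEv event
          act≡   : act (gt event) ≡ a
          pre≡   : pre event i ≡ b
          base   : Base
          equiv  : Equiv c (just index) (marking base i)
          silent : Silent (state (marking base)) g

      -- The events fired before the interface event m but not in its past are
      -- concurrent with m; they are postponed until after m.
      interface-move : (B : Base) → Silent (state (marking B)) g → GStep g t g′ → inI (act t) ≡ true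
                     → InterfaceMove (marking B i) (act t) g′
      interface-move B sil s a∈
        with B₁ , st₁ , mi ← advance-silent B (λ _ → refl) sil
        with m , e , M₂ , eq , act≡ , f , st₂ ← advance B₁ (GStep-resp (λ j → sym (st₁ j)) (λ _ → refl) s)
        with x , e′ , eqx , iex , m~x , transfer ← uncut-companion eq (trans (cong inI act≡) a∈)
        with M₁ , ms₂ , s₁ , s₂ ← split (λ y → past? y m) past-downClosed (seg B₁ ▷ f) = record
        { index  = m
        ; event  = e
        ; lookup = eq
        ; ie     = ie
        ; act≡   = act≡
        ; pre≡   = trans (proj₁ moved) mi
        ; base   = record
            { marking = Lx.after ; fired = x ∷ Lx.past ; seg = Lx.seg
            ; allFree = λ { (here refl) → e′ , eqx ; (there y∈) → past-free (local (ev eqx)) y∈ } }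
        ; equiv  = subst (Equiv c (just m)) (sym (Lx.after-i iex)) m~x
        -- The postponed events lead from St(m) to the state reached by the run, and the uncut event
        -- `x` has the same state as `m`.
        ; silent = silent-respˡ (λ j → trans (cong (lab j) (same j)) (Lx.st⇒ (transfer (Lm.st⇐ λ _ → refl)) j))
                     (silent-++ (seg-silent s₂ (unmoved s₁ s₂ (restrict-agree (λ y → past? y m) (seg B₁ ▷ f) s₁ last)))
                                (done st₂))
        }
        where
        ie : IsIEv e
        ie = trans (cong inI act≡) a∈
        moved : pre e i ≡ marking B₁ i × M₂ i ≡ just m
        moved = fire-moved f eq (proj₂ (interface-moves (valid e) ie))
        module Lx = Local (local (ev eqx))
        module Lm = Local (local eq)
        last : ∀ {y} → M₂ i ≡ just y → Past (evs c) y m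
        last r = subst (λ z → Past (evs c) z m) (unjust (proj₂ moved) r) here
        same : M₁ ≐ Lm.after
        same = seg-unique s₁ Lm.seg
          (λ y∈ → Lm.past⇒seg (proj₂ (∈-filter⁻ (λ y → past? y m) {xs = m ∷ fired B₁} y∈)))
          (λ y∈ → ∈-filter⁺ (λ y → past? y m)
                    (seg-past (seg B₁ ▷ f) (here refl) (Lm.seg⇒past y∈)) (Lm.seg⇒past y∈))

      complete-fin : ∀ {b ts} (B : Base) → Equiv c b (marking B i) → Silent (state (marking B)) g
                   → FinRun g ts → FoldRun c b (projL (map act ts))
      complete-fin B b~ sil [] = []
      complete-fin B b~ sil (_∷_ {t = t} s r) with inI (act t) in a
      -- Silent actions are only accumulated here; the net replays them at the next interface
      -- action, if there is one.
      ... | false = complete-fin B b~ (silent-snoc sil a s) r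
      ... | true  = subst (λ z → FoldRun c _ (z ∷ _)) act≡
        (step lookup ie (subst (Equiv c _) (sym pre≡) b~) (complete-fin base equiv silent r))
        where open InterfaceMove (interface-move B sil s a)

      complete-inf : ∀ {u} → ProjInf u → FoldInf c u
      complete-inf {u} (w , (ts , gs , gs≐ , steps , w≡) , f , f< , f-vis , f-u , f-all) =
        (λ l → InterfaceMove.index (at l)) , (λ l → InterfaceMove.event (at l)) ,
        (λ l → InterfaceMove.lookup (at l)) , (λ l → InterfaceMove.ie (at l)) ,
        subst (Equiv c nothing) (sym (InterfaceMove.pre≡ (at 0))) ε ,
        (λ l → subst (Equiv c _) (sym (InterfaceMove.pre≡ (at (suc l)))) (InterfaceMove.equiv (at l))) ,
        λ l → trans (sym (f-u l)) (trans (w≡ (f l)) (sym (InterfaceMove.act≡ (at l))))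
        where
        -- The position in the run at which stage `l` begins: the start, or right after the
        -- preceding interface action.
        pos : ℕ → ℕ
        pos zero    = 0
        pos (suc l) = suc (f l)

        pos≤f : ∀ l → pos l ≤ f l
        pos≤f zero    = z≤n
        pos≤f (suc l) = f< l

        f-mono : ∀ {l l′} → l ≤′ l′ → f l ≤ f l′
        f-mono ≤′-refl        = ≤-refl
        f-mono (≤′-step l≤l′) = ≤-trans (f-mono l≤l′) (<⇒≤ (f< _))

        between : ∀ l l′ → pos l ≤ f l′ → ¬ f l′ < f l
        between zero    l′ _   f<l = <⇒≱ f<l (f-mono (≤⇒≤′ z≤n))
        between (suc l) l′ l≤f f<l with <-≤-connex l l′
        ... | inj₁ l<l′ = <⇒≱ f<l (f-mono (≤⇒≤′ l<l′))
        ... | inj₂ l′≤l = <⇒≱ l≤f (f-mono (≤⇒≤′ l′≤l))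

        quiet : ∀ l m → pos l ≤ m → m < f l → inI (act (ts m)) ≡ false
        quiet l m l≤m m<f with inI (act (ts m)) in a
        ... | false = refl
        -- A visible position is a value of the increasing `f`, and none lies before the first value
        -- or strictly between consecutive ones.
        ... | true with l′ , refl ← f-all m (trans (cong inI (w≡ m)) a) = contradiction m<f (between l l′ l≤m)

        waiting : ∀ {x y} → x ≤′ y → (∀ m → x ≤ m → m < y → inI (act (ts m)) ≡ false) → Silent (gs x) (gs y)
        waiting ≤′-refl         q = done λ _ → refl
        waiting (≤′-step x≤y) q = silent-snoc (waiting x≤y λ m x≤m m<y → q m x≤m (m<n⇒m<1+n m<y))
                                              (q _ (≤′⇒≤ x≤y) ≤-refl) (steps _)

        Stage : ℕ → Set
        Stage l = ∃[ B ] Silent (state (marking B)) (gs (pos l))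

        move-at : ∀ l → (S : Stage l) → InterfaceMove (marking (proj₁ S) i) (act (ts (f l))) (gs (suc (f l)))
        move-at l (B , sil) =
          interface-move B (silent-++ sil (waiting (≤⇒≤′ (pos≤f l)) (quiet l))) (steps (f l))
                         (trans (cong inI (sym (w≡ (f l)))) (f-vis l))

        stage : ∀ l → Stage l
        stage zero    = base₀ , done λ j → sym (gs≐ j)
        stage (suc l) = InterfaceMove.base mv , InterfaceMove.silent mv
          where mv = move-at l (stage l)

        at : ∀ l → InterfaceMove (marking (proj₁ (stage l)) i) (act (ts (f l))) (gs (suc (f l)))
        at l = move-at l (stage l)

    summary : NonDivergent → Final c → IsSummary c
    summary nd final =
      (λ u → mk⇔ (λ r → let ts , r′ , eq = sound-fin r (at-start λ _ → refl) in inj₁ (_ , (ts , r′ , refl) , eq))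
        λ { (inj₁ (_ , (ts , r , refl) , refl)) → complete-fin base₀ ε (done λ _ → refl) r
          -- An infinite trace with finite projection is exactly a witness of divergence.
          ; (inj₂ (w , inf , N , _ , quiet)) → contradiction (w , inf , N , quiet) nd }) ,
      λ u → mk⇔ sound-inf complete-inf
      where open Completeness final

theorem1 : ∀ {k n : ℕ} (A : Fin n → FLTS k) (i : Fin n)
    → Composition.NonDivergent A i
    → Composition.Terminates A i
    × (∀ c → Composition.Reachable A i c → Composition.Final A i c
    → Composition.IsBP A i (Composition.evs A i c) × Composition.IsSummary A i c)
theorem1 A i nd =
  terminates nd ,
  λ c r final → Good.bp (reachable-good r) , Folding.summary c (reachable-good r) nd final
  where open Unfolding A i
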